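{- Let $u$ be a primitive word of length $n$, and let $f,g\colon[1,m]\to[1,n]$ be walks. Then $u^f=u^g$ if and only if $\langle f(i),g(i)\rangle\in\Delta^*(u)$ for all $i\in[1,m]$.
   Context: Words are over a fixed alphabet. For integers $i,k$, $[i,k]=\{j\in\mathbb{Z} : i\le j\le k\}$. For a word $u=a_1\cdots a_n$, $u[i]=a_i$ and $u[i,j]=a_i\cdots a_j$; for $f\colon[1,m]\to[1,n]$, $u^f=a_{f(1)}\cdots a_{f(m)}$. A walk is a surjection $f\colon[1,m]\to[1,n]$ with $|f(i+1)-f(i)|\le 1$ for $1\le i<m$. A word $u$ generates $w$ if $w=u^f$ for some walk $f$; $u$ is primitive if it is not generated by any strictly shorter word. A non-trivial palindrome is a word of length at least $2$ equal to its reversal. A defect of $u$ is an ordered pair $\langle i,j\rangle$ such that $u[i,j]$ is a non-trivial palindrome; $\Delta(u)$ is the set of defects of $u$, regarded as a binary relation on $[1,n]$, and $\Delta^*(u)$ is its equivalence closure (the smallest reflexive, symmetric and transitive relation on $[1,n]$ containing $\Delta(u)$). -}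

module Defs where

open import Data.Nat using (ℕ; suc; _+_; _∸_; _≤_; _<_)
open import Data.Fin using (Fin; toℕ)
open import Data.Vec using (Vec; lookup; tabulate; toList)
open import Data.List using (List; take; drop; reverse)
open import Data.Product using (Σ; ∃; _×_)
open import Relation.Nullary using (¬_)
open import Relation.Binary.PropositionalEquality using (_≡_)
open import Relation.Binary.Construct.Closure.Equivalence using (EqClosure)

-- Words of length n over an alphabet A are vectors; positions [1,n] are
-- represented 0-based by Fin n (position k ↔ Fin element with toℕ = k-1).

_^_ : ∀ {A : Set} {m n : ℕ} → Vec A n → (Fin m → Fin n) → Vec A m
u ^ f = tabulate (λ i → lookup u (f i))

IsWalk : ∀ {m n : ℕ} → (Fin m → Fin n) → Set
IsWalk {m} {n} f =
  (∀ (y : Fin n) → ∃ λ (x : Fin m) → f x ≡ y) ×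
  (∀ (i j : Fin m) → toℕ j ≡ suc (toℕ i) →
     (toℕ (f j) ≤ suc (toℕ (f i))) × (toℕ (f i) ≤ suc (toℕ (f j))))

Generates : ∀ {A : Set} {k m : ℕ} → Vec A k → Vec A m → Set
Generates {A} {k} {m} u w = Σ (Fin m → Fin k) (λ f → IsWalk f × (u ^ f ≡ w))

Primitive : ∀ {A : Set} {n : ℕ} → Vec A n → Set
Primitive {A} {n} u = ∀ (k : ℕ) (v : Vec A k) → k < n → ¬ Generates v u

factor : ∀ {A : Set} {n : ℕ} → Vec A n → Fin n → Fin n → List A
factor u i j = take (suc (toℕ j ∸ toℕ i)) (drop (toℕ i) (toList u))

Defect : ∀ {A : Set} {n : ℕ} → Vec A n → Fin n → Fin n → Set
Defect u i j = (toℕ i < toℕ j) × (reverse (factor u i j) ≡ factor u i j)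

Δ* : ∀ {A : Set} {n : ℕ} → Vec A n → Fin n → Fin n → Set
Δ* u = EqClosure (Defect u)

{-# OPTIONS --safe #-}
module Submission where

-- Call a position of w = u^f a mirror of radius d if it is an end of w or the centre of a
-- palindromic factor of radius d; two mirrors of radius d at distance d allow w to be folded to a
-- shorter word generating it.  A primitive u has no folds and no stutters.  Removing a stutter
-- from w, or folding w along a fold of minimal radius d, is followed by every walk f with u^f = w:
-- the turning points and ends of f are themselves mirrors, so by minimality f can turn near the
-- fold only at its two mirrors.  If f passes straight over one of them, the palindrome there is a
-- defect of u, so the positions that the folding identifies are Δ*-related; and f must turn at one
-- of them, since otherwise u itself has a fold.  Hence by induction on the length of w it remains
-- to treat words w without folds, which f and g traverse without turning, so that f and g are the
-- identity or the reversal of u.  The alphabet may be assumed decidable by replacing each letter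
-- with the class of its positions under the equivalence generated by f(i) ~ g(i).

open import Defs
open import Data.Bool using (Bool; true; false; T; _∧_; _∨_)
open import Data.Bool.Properties using (T-∧; T-∨)
open import Data.Empty using (⊥; ⊥-elim)
open import Data.Fin using (Fin; zero; suc; toℕ)
import Data.Fin.Properties as Fin
open import Data.List using (take; drop; reverse; applyUpTo; applyDownFrom)
import Data.List as List
import Data.List.Properties as List
open import Data.Nat using (ℕ; zero; suc; pred; _+_; _*_; _∸_; _≤_; _<_; z≤n; s≤s; _≤ᵇ_; _≟_; _<?_; _≤?_)
open import Data.Nat.Induction using (<-rec)
open import Data.Nat.Properties
open import Data.Nat.Tactic.RingSolver using (solve-∀)
open import Data.Product using (∃; _×_; _,_; proj₁; proj₂)
open import Data.Sum using (_⊎_; inj₁; inj₂; [_,_]′)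
open import Data.Vec using (Vec; []; _∷_; lookup; tabulate; toList; replicate; zipWith; allFin; map)
open import Data.Vec.N-ary using (N-ary; _$ⁿ_)
open import Data.Vec.Properties using (lookup∘tabulate; tabulate∘lookup; tabulate-cong)
open import Function.Bundles using (_⇔_; mk⇔; module Equivalence)
open import Relation.Binary.Definitions using (tri<; tri≈; tri>)
open import Relation.Binary.PropositionalEquality
open import Relation.Binary.Structures using (IsEquivalence)
open import Relation.Nullary using (¬_; Dec; yes; no; contradiction)
open import Relation.Nullary.Decidable using (map′; _×-dec_)
import Relation.Binary.Construct.Closure.Equivalence as EqClosure
import Relation.Binary.Construct.On as On

-- Linear arithmetic over ℕ

infixl 6 _⊕_
infix 4 _≼_ _≈_
infix 3 ⊢_
infixr 2 _⇒_

data Expr (k : ℕ) : Set where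
  ‵_ : Fin k → Expr k
  #_ : ℕ → Expr k
  _⊕_ : Expr k → Expr k → Expr k

data Atom (k : ℕ) : Set where
  _≼_ _≈_ : Expr k → Expr k → Atom k
  false′ : Atom k

data Sequent (k : ℕ) : Set where
  ⊢_ : Atom k → Sequent k
  _⇒_ : Atom k → Sequent k → Sequent k

module _ {k : ℕ} (ρ : Vec ℕ k) where

  ⟦_⟧ : Expr k → ℕ
  ⟦ ‵ i ⟧ = lookup ρ i
  ⟦ # n ⟧ = n
  ⟦ x ⊕ y ⟧ = ⟦ x ⟧ + ⟦ y ⟧

  ⟦_⟧ᵃ : Atom k → Set
  ⟦ x ≼ y ⟧ᵃ = ⟦ x ⟧ ≤ ⟦ y ⟧
  ⟦ x ≈ y ⟧ᵃ = ⟦ x ⟧ ≡ ⟦ y ⟧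
  ⟦ false′ ⟧ᵃ = ⊥

  ⟦_⟧ˢ : Sequent k → Set
  ⟦ ⊢ g ⟧ˢ = ⟦ g ⟧ᵃ
  ⟦ h ⇒ s ⟧ˢ = ⟦ h ⟧ᵃ → ⟦ s ⟧ˢ

dot : ∀ {k} → Vec ℕ k → Vec ℕ k → ℕ
dot [] [] = 0
dot (x ∷ xs) (y ∷ ys) = x * y + dot xs ys

unit : ∀ {k} → Fin k → Vec ℕ k
unit zero = 1 ∷ replicate _ 0
unit (suc i) = 0 ∷ unit i

_⊞_ : ∀ {k} → Vec ℕ k → Vec ℕ k → Vec ℕ k
_⊞_ = zipWith _+_

-- Entry 0 is the constant term, so coefficient vectors are evaluated at `1 ∷ ρ`.
coeffs : ∀ {k} → Expr k → Vec ℕ (suc k)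
coeffs (‵ i) = 0 ∷ unit i
coeffs (# n) = n ∷ replicate _ 0
coeffs (x ⊕ y) = coeffs x ⊞ coeffs y

dot-zero : ∀ {k} (ρ : Vec ℕ k) → dot (replicate k 0) ρ ≡ 0
dot-zero [] = refl
dot-zero (_ ∷ ρ) = dot-zero ρ

dot-unit : ∀ {k} (i : Fin k) (ρ : Vec ℕ k) → dot (unit i) ρ ≡ lookup ρ i
dot-unit zero (x ∷ ρ) rewrite dot-zero ρ = trans (+-identityʳ _) (+-identityʳ x)
dot-unit (suc i) (_ ∷ ρ) = dot-unit i ρ

dot-⊞ : ∀ {k} (xs ys ρ : Vec ℕ k) → dot (xs ⊞ ys) ρ ≡ dot xs ρ + dot ys ρ
dot-⊞ [] [] [] = refl
dot-⊞ (x ∷ xs) (y ∷ ys) (r ∷ ρ) rewrite dot-⊞ xs ys ρ = rearrange x y r (dot xs ρ) (dot ys ρ)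
  where
  rearrange : ∀ x y r p q → (x + y) * r + (p + q) ≡ x * r + p + (y * r + q)
  rearrange = solve-∀

coeffs-sound : ∀ {k} (ρ : Vec ℕ k) (e : Expr k) → dot (coeffs e) (1 ∷ ρ) ≡ ⟦ ρ ⟧ e
coeffs-sound ρ (‵ i) = dot-unit i ρ
coeffs-sound ρ (# n) rewrite dot-zero ρ = trans (+-identityʳ _) (*-identityʳ n)
coeffs-sound ρ (x ⊕ y) =
  trans (dot-⊞ (coeffs x) (coeffs y) (1 ∷ ρ)) (cong₂ _+_ (coeffs-sound ρ x) (coeffs-sound ρ y))

_≤ᵛ_ : ∀ {k} → Vec ℕ k → Vec ℕ k → Bool
[] ≤ᵛ [] = true
(x ∷ xs) ≤ᵛ (y ∷ ys) = (x ≤ᵇ y) ∧ (xs ≤ᵛ ys)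

≤ᵛ-sound : ∀ {k} (xs ys ρ : Vec ℕ k) → T (xs ≤ᵛ ys) → dot xs ρ ≤ dot ys ρ
≤ᵛ-sound [] [] [] _ = z≤n
≤ᵛ-sound (x ∷ xs) (y ∷ ys) (r ∷ ρ) t =
  let p , q = Equivalence.to T-∧ t
  in +-mono-≤ (*-monoˡ-≤ r (≤ᵇ⇒≤ x y p)) (≤ᵛ-sound xs ys ρ q)

-- A goal x ≼ y follows from an accumulated inequality p ≼ q, a non-negative combination of the
-- hypotheses, as soon as x ⊕ q ≼ y ⊕ p holds coefficientwise.
module _ {k : ℕ} where

  entails : Vec ℕ (suc k) → Vec ℕ (suc k) → Atom k → Bool
  entails p q (x ≼ y) = (coeffs x ⊞ q) ≤ᵛ (coeffs y ⊞ p)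
  entails p q (x ≈ y) = false
  entails p q false′ = (coeffs (# 1) ⊞ q) ≤ᵛ p

  -- Backtracking over weights 0 and 1 for the hypotheses; an equation may be used in either
  -- direction. This is incomplete, but enough for the goals below.
  search : Vec ℕ (suc k) → Vec ℕ (suc k) → Sequent k → Bool
  search p q (⊢ g) = entails p q g
  search p q ((x ≼ y) ⇒ s) =
    search (p ⊞ coeffs x) (q ⊞ coeffs y) s ∨ search p q s
  search p q ((x ≈ y) ⇒ s) =
    search (p ⊞ coeffs x) (q ⊞ coeffs y) s ∨
    (search (p ⊞ coeffs y) (q ⊞ coeffs x) s ∨ search p q s)
  search p q (false′ ⇒ s) = true

  combine : ∀ ρ p q (x y : Expr k) → dot p (1 ∷ ρ) ≤ dot q (1 ∷ ρ) → ⟦ ρ ⟧ x ≤ ⟦ ρ ⟧ y →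
            dot (p ⊞ coeffs x) (1 ∷ ρ) ≤ dot (q ⊞ coeffs y) (1 ∷ ρ)
  combine ρ p q x y p≤q x≤y
    rewrite dot-⊞ p (coeffs x) (1 ∷ ρ) | dot-⊞ q (coeffs y) (1 ∷ ρ)
          | coeffs-sound ρ x | coeffs-sound ρ y = +-mono-≤ p≤q x≤y

  search-sound : ∀ ρ p q s → dot p (1 ∷ ρ) ≤ dot q (1 ∷ ρ) → T (search p q s) → ⟦ ρ ⟧ˢ s
  search-sound ρ p q (⊢ x ≼ y) p≤q t = +-cancelʳ-≤ (dot q (1 ∷ ρ)) _ _ (begin
    ⟦ ρ ⟧ x + dot q (1 ∷ ρ) ≡⟨ cong (_+ _) (coeffs-sound ρ x) ⟨
    dot (coeffs x) (1 ∷ ρ) + dot q (1 ∷ ρ) ≡⟨ dot-⊞ (coeffs x) q (1 ∷ ρ) ⟨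
    dot (coeffs x ⊞ q) (1 ∷ ρ) ≤⟨ ≤ᵛ-sound (coeffs x ⊞ q) (coeffs y ⊞ p) (1 ∷ ρ) t ⟩
    dot (coeffs y ⊞ p) (1 ∷ ρ) ≡⟨ dot-⊞ (coeffs y) p (1 ∷ ρ) ⟩
    dot (coeffs y) (1 ∷ ρ) + dot p (1 ∷ ρ) ≤⟨ +-monoʳ-≤ _ p≤q ⟩
    dot (coeffs y) (1 ∷ ρ) + dot q (1 ∷ ρ) ≡⟨ cong (_+ _) (coeffs-sound ρ y) ⟩
    ⟦ ρ ⟧ y + dot q (1 ∷ ρ) ∎)
    where open ≤-Reasoning
  search-sound ρ p q (⊢ false′) p≤q t = n≮n _ (begin
    suc (dot q (1 ∷ ρ)) ≡⟨ cong (_+ dot q (1 ∷ ρ)) (coeffs-sound ρ (# 1)) ⟨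
    dot (coeffs {k} (# 1)) (1 ∷ ρ) + dot q (1 ∷ ρ) ≡⟨ dot-⊞ (coeffs (# 1)) q (1 ∷ ρ) ⟨
    dot (coeffs (# 1) ⊞ q) (1 ∷ ρ) ≤⟨ ≤ᵛ-sound (coeffs (# 1) ⊞ q) p (1 ∷ ρ) t ⟩
    dot p (1 ∷ ρ) ≤⟨ p≤q ⟩
    dot q (1 ∷ ρ) ∎)
    where open ≤-Reasoning
  search-sound ρ p q ((x ≼ y) ⇒ s) p≤q t h with Equivalence.to T-∨ t
  ... | inj₁ t₁ = search-sound ρ _ _ s (combine ρ p q x y p≤q h) t₁
  ... | inj₂ t₂ = search-sound ρ p q s p≤q t₂
  search-sound ρ p q ((x ≈ y) ⇒ s) p≤q t h with Equivalence.to T-∨ t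
  ... | inj₁ t₁ = search-sound ρ _ _ s (combine ρ p q x y p≤q (≤-reflexive h)) t₁
  ... | inj₂ t₂ with Equivalence.to T-∨ t₂
  ... | inj₁ t₁ = search-sound ρ _ _ s (combine ρ p q y x p≤q (≤-reflexive (sym h))) t₁
  ... | inj₂ t₃ = search-sound ρ p q s p≤q t₃
  search-sound ρ p q (false′ ⇒ s) p≤q t ()

-- `entails` rejects equations, so an equational goal is searched for twice, once as each of its two
-- inequalities.
onGoal : ∀ {k} → (Atom k → Atom k) → Sequent k → Sequent k
onGoal φ (⊢ g) = ⊢ φ g
onGoal φ (h ⇒ s) = h ⇒ onGoal φ s

below above : ∀ {k} → Atom k → Atom k
below (x ≈ y) = x ≼ y
below g = g
above (x ≈ y) = y ≼ x
above g = g

split-goal : ∀ {k} (ρ : Vec ℕ k) s → ⟦ ρ ⟧ˢ (onGoal below s) → ⟦ ρ ⟧ˢ (onGoal above s) → ⟦ ρ ⟧ˢ s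
split-goal ρ (⊢ x ≼ y) p q = p
split-goal ρ (⊢ x ≈ y) p q = ≤-antisym p q
split-goal ρ (⊢ false′) p q = p
split-goal ρ (h ⇒ s) p q x = split-goal ρ s (p x) (q x)

valid : ∀ {k} → Sequent k → Bool
valid s = search (replicate _ 0) (replicate _ 0) (onGoal below s) ∧
          search (replicate _ 0) (replicate _ 0) (onGoal above s)

close : ∀ {k} → N-ary k (Expr k) (Sequent k) → Sequent k
close {k} φ = φ $ⁿ map ‵_ (allFin k)

-- The implicit certificate becomes the unit type when the search succeeds, so it is supplied by
-- evaluation alone.
lin : ∀ {k} (ρ : Vec ℕ k) (φ : N-ary k (Expr k) (Sequent k)) {_ : T (valid (close φ))} → ⟦ ρ ⟧ˢ (close φ)
lin {k} ρ φ {t} =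
  split-goal ρ s (search-sound ρ 0s 0s (onGoal below s) ≤-refl (proj₁ both))
                 (search-sound ρ 0s 0s (onGoal above s) ≤-refl (proj₂ both))
  where
  s = close φ
  0s = replicate (suc k) 0
  both : T (search 0s 0s (onGoal below s)) × T (search 0s 0s (onGoal above s))
  both = Equivalence.to T-∧ t

-- Palindromes, mirrors and folds

Near : ℕ → ℕ → Set
Near x y = x ≤ suc y × y ≤ suc x

near-refl : ∀ x → Near x x
near-refl x = n≤1+n x , n≤1+n x

near-suc : ∀ x → Near (suc x) x
near-suc x = ≤-refl , ≤-trans (n≤1+n x) (n≤1+n (suc x))

near-sym : ∀ {x y} → Near x y → Near y x
near-sym (p , q) = q , p

-- The factor of w with centre c and radius d (hence of length 2d+1) is a palindrome.
Pal : (ℕ → ℕ) → ℕ → ℕ → Set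
Pal w c d = ∀ s k → s + k ≡ c → s ≤ d → w k ≡ w (s + c)

-- Words of length M+1 are functions on ℕ restricted to [0,M].
data Mirror (w : ℕ → ℕ) (M d : ℕ) : ℕ → Set where
  start : Mirror w M d 0
  end   : Mirror w M d M
  mid   : ∀ {c} → d ≤ c → d + c ≤ M → Pal w c d → Mirror w M d c

mirror-≤ : ∀ {w M d e c} → e ≤ d → Mirror w M d c → Mirror w M e c
mirror-≤ e≤d start = start
mirror-≤ e≤d end = end
mirror-≤ {M = M} {d} {e} {c} e≤d (mid d≤c d+c≤M pal) =
  mid (≤-trans e≤d d≤c) (≤-trans (+-monoˡ-≤ c e≤d) d+c≤M) (λ s k eq s≤e → pal s k eq (≤-trans s≤e e≤d))

-- `d<M` excludes the two ends of the word, which are mirrors at distance `M` without any palindrome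
-- behind them.
record Fold (w : ℕ → ℕ) (M d : ℕ) : Set where
  constructor fold
  field
    centre : ℕ
    0<d : 0 < d
    d<M : d < M
    fits : d + centre ≤ M
    left : Mirror w M d centre
    right : Mirror w M d (d + centre)

-- The cases differ in which of the two mirrors is an end of the word. The folded part is [0,2d],
-- [a,M] or [a,a+3d], with `a` positions before it and `b` after it.
data Shape (w : ℕ → ℕ) (M d : ℕ) : Set where
  prefix : ∀ b → M ≡ b + (d + d) → Pal w d d → Shape w M d
  suffix : ∀ a → M ≡ d + (d + a) → Pal w (d + a) d → Shape w M d
  zigzag : ∀ a b → M ≡ b + (d + (d + (d + a))) → Pal w (d + a) d → Pal w (d + (d + a)) d → Shape w M d

shape : ∀ {w M d} → Fold w M d → Shape w M d
shape {w} {M} {d} (fold V 0<d d<M fits l r) = go V fits l (d + V) refl r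
  where
  go : ∀ V → d + V ≤ M → Mirror w M d V → ∀ W → d + V ≡ W → Mirror w M d W → Shape w M d
  go V fits end W eq r =
    ⊥-elim (lin (d ∷ V ∷ []) (λ d V → # 1 ≼ d ⇒ d ⊕ V ≼ V ⇒ ⊢ false′) 0<d fits)
  go V fits l W eq start = ⊥-elim (lin (d ∷ V ∷ []) (λ d V → # 1 ≼ d ⇒ d ⊕ V ≈ # 0 ⇒ ⊢ false′) 0<d eq)
  go _ fits start W eq end =
    ⊥-elim (lin (d ∷ M ∷ []) (λ d M → # 1 ⊕ d ≼ M ⇒ d ⊕ # 0 ≈ M ⇒ ⊢ false′) d<M eq)
  go _ fits start W eq (mid d≤W bd pal) with m≤n⇒∃[o]m+o≡n bd
  ... | b , eb with trans (sym eq) (+-identityʳ d)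
  ... | refl = prefix b (trans (sym eb) (+-comm (d + d) b)) pal
  go V fits (mid d≤V bd pal) W eq end with m≤n⇒∃[o]m+o≡n d≤V
  ... | a , refl = suffix a (sym eq) pal
  go V fits (mid d≤V _ pal) W refl (mid _ bd pal′) with m≤n⇒∃[o]m+o≡n d≤V
  ... | a , refl with m≤n⇒∃[o]m+o≡n bd
  ... | b , eb = zigzag a b (trans (sym eb) (+-comm _ b)) pal pal′

-- A witness that `w` is generated by the shorter word `w ∘ e` along the walk `r`; the section `e`
-- chooses a position of `w` for each of its letters.
record Retract (w : ℕ → ℕ) (M : ℕ) : Set where
  field
    M′ : ℕ
    M′<M : M′ < M
    r e : ℕ → ℕ
    r-bound : ∀ i → i ≤ M → r i ≤ M′
    e-bound : ∀ j → j ≤ M′ → e j ≤ M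
    r∘e : ∀ j → j ≤ M′ → r (e j) ≡ j
    r-step : ∀ i → i < M → Near (r (suc i)) (r i)
    w∘e∘r : ∀ i → i ≤ M → w i ≡ w (e (r i))

-- Enumerates the indices outside the block [p, p+k).
cut : ℕ → ℕ → ℕ → ℕ
cut p k j with j <? p
... | yes _ = j
... | no _  = k + j

cut-< : ∀ {p k j} → j < p → cut p k j ≡ j
cut-< {p} {k} {j} j<p with j <? p
... | yes _ = refl
... | no j≮p = contradiction j<p j≮p

cut-≥ : ∀ {p k j} → p ≤ j → cut p k j ≡ k + j
cut-≥ {p} {k} {j} p≤j with j <? p
... | yes j<p = contradiction p≤j (<⇒≱ j<p)
... | no _ = refl

cut-bound : ∀ p k {j M′} → j ≤ M′ → cut p k j ≤ k + M′
cut-bound p k {j} {M′} j≤M′ with j <? p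
... | yes _ = ≤-trans j≤M′ (m≤n+m M′ k)
... | no _ = +-monoʳ-≤ k j≤M′

-- For V = d+a this folds the line at V and d+V, i.e. i ↦ i, 2V−i, i−2d on the three pieces; for
-- V = a = 0 it is i ↦ ∣i−d∣.
bend : ℕ → ℕ → ℕ → ℕ → ℕ
bend V d a i with i <? V
... | yes _ = i
... | no _ = ((d + V) ∸ i) + (i ∸ (d + V)) + a

-- In the middle piece `s` and `t` are the distances of `i` from the folding points `V` and `d + V`.
data Region (V d i : ℕ) : Set where
  lo : i < V → Region V d i
  md : ∀ s t → t + s ≡ d → i ≡ s + V → Region V d i
  hi : ∀ s → i ≡ suc s + (d + V) → Region V d i

region : ∀ V d i → Region V d i
region V d i with i <? V
... | yes i<V = lo i<V
... | no i≮V with m≤n⇒∃[o]m+o≡n (≮⇒≥ i≮V)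
... | s , refl with s ≤? d
... | yes s≤d with m≤n⇒∃[o]m+o≡n s≤d
...   | t , eq = md s t (trans (+-comm t s) eq) (+-comm V s)
region V d i | no i≮V | s , refl | no s≰d with m≤n⇒∃[o]m+o≡n (≰⇒> s≰d)
... | t , refl = hi t (lin (V ∷ d ∷ t ∷ []) (λ V d t → ⊢ V ⊕ (# 1 ⊕ (d ⊕ t)) ≈ # 1 ⊕ (t ⊕ (d ⊕ V))))

module _ (V d a : ℕ) where

  bend-lo : ∀ {i} → i < V → bend V d a i ≡ i
  bend-lo {i} i<V with i <? V
  ... | yes _ = refl
  ... | no i≮V = contradiction i<V i≮V

  private
    bend-≥ : ∀ {i} → V ≤ i → bend V d a i ≡ ((d + V) ∸ i) + (i ∸ (d + V)) + a
    bend-≥ {i} V≤i with i <? V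
    ... | yes i<V = contradiction V≤i (<⇒≱ i<V)
    ... | no _ = refl

  bend-md : ∀ s t → t + s ≡ d → bend V d a (s + V) ≡ t + a
  bend-md s t refl = trans (bend-≥ (m≤n+m V s)) (cong (_+ a) (trans (cong₂ _+_ p q) (+-identityʳ t)))
    where
    p : t + s + V ∸ (s + V) ≡ t
    p = trans (cong (_∸ (s + V)) (+-assoc t s V)) (m+n∸n≡m t (s + V))
    q : s + V ∸ (t + s + V) ≡ 0
    q = m≤n⇒m∸n≡0 (+-monoˡ-≤ V (m≤n+m s t))

  bend-hi : ∀ s → bend V d a (s + (d + V)) ≡ s + a
  bend-hi s = trans (bend-≥ (≤-trans (m≤n+m V d) (m≤n+m (d + V) s)))
    (cong (_+ a) (cong₂ _+_ (m≤n⇒m∸n≡0 (m≤n+m (d + V) s)) (m+n∸n≡m s (d + V))))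

  -- The pieces always meet at `d + V`. At `V` they meet if `V` is `d + a`, while for `V` equal to 0
  -- the first piece is empty.
  bend-step : V ≡ 0 ⊎ V ≡ d + a → ∀ i → Near (bend V d a (suc i)) (bend V d a i)
  bend-step V≡ i with region V d i
  ... | hi s refl rewrite bend-hi (suc s) | bend-hi (suc (suc s)) = near-suc (suc s + a)
  ... | md s zero refl refl rewrite bend-md s 0 refl | bend-hi 1 = near-suc a
  ... | md s (suc t) refl refl
        rewrite bend-md s (suc t) refl | bend-md (suc s) t (+-suc t s) = near-sym (near-suc (t + a))
  ... | lo i<V with m≤n⇒m<n∨m≡n i<V
  ...   | inj₁ 1+i<V rewrite bend-lo i<V | bend-lo 1+i<V = near-suc i
  ...   | inj₂ refl rewrite bend-lo i<V with V≡
  ...     | inj₂ eq rewrite bend-md 0 d (+-identityʳ d) | sym eq = near-suc i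

-- With equality of letters for `S` this is `Pal`. The covering lemmas are used both for that
-- relation, to build retractions, and for `f i ~ f j`, to lift walks.
Reflects : (ℕ → ℕ → Set) → ℕ → ℕ → Set
Reflects S c d = ∀ s k → s + k ≡ c → s ≤ d → S k (s + c)

module Cover {S : ℕ → ℕ → Set} (E : IsEquivalence S) where
  open IsEquivalence E renaming (refl to ~refl; sym to ~sym; trans to ~trans; reflexive to ~≡)

  prefix-cover : ∀ d → Reflects S d d → ∀ i → S i (cut 0 d (bend 0 d 0 i))
  prefix-cover d refl-d i rewrite cut-≥ {0} {d} {bend 0 d 0 i} z≤n with region 0 d i
  ... | md s t refl refl rewrite bend-md 0 (t + s) 0 s t refl =
    ~trans (~≡ (+-identityʳ s)) (~trans (refl-d t s refl (m≤m+n t s))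
      (~≡ (lin (s ∷ t ∷ []) (λ s t → ⊢ t ⊕ (t ⊕ s) ≈ t ⊕ s ⊕ (t ⊕ # 0)))))
  ... | hi s refl rewrite bend-hi 0 d 0 (suc s) =
    ~≡ (lin (s ∷ d ∷ []) (λ s d → ⊢ # 1 ⊕ (s ⊕ (d ⊕ # 0)) ≈ d ⊕ (# 1 ⊕ (s ⊕ # 0))))

  suffix-cover : ∀ d a → Reflects S (d + a) d → ∀ i → i ≤ d + (d + a) → S i (bend (d + a) d a i)
  suffix-cover d a refl-V i i≤M with region (d + a) d i
  ... | lo i<V rewrite bend-lo (d + a) d a i<V = ~refl
  ... | md s t refl refl rewrite bend-md (t + s + a) (t + s) a s t refl =
    ~sym (refl-V s (t + a) (lin (s ∷ t ∷ a ∷ []) (λ s t a → ⊢ s ⊕ (t ⊕ a) ≈ t ⊕ s ⊕ a)) (m≤n+m s t))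
  ... | hi s refl = ⊥-elim (m+1+n≰m _ (subst (_≤ d + (d + a)) (+-comm (suc s) _) i≤M))

  module _ (d a : ℕ) (refl-V : Reflects S (d + a) d) (refl-W : Reflects S (d + (d + a)) d) where

    -- Reflecting in `d + a` and then in `d + (d + a)` is translation by 2d.
    shift : ∀ t s → t + s ≡ d → S (t + a) (d + d + (t + a))
    shift t s refl = ~trans
      (refl-V s (t + a) (lin (s ∷ t ∷ a ∷ []) (λ s t a → ⊢ s ⊕ (t ⊕ a) ≈ t ⊕ s ⊕ a)) (m≤n+m s t))
      (~trans (refl-W t (s + (d + a)) (sym (+-assoc t s (d + a))) (m≤m+n t s))
        (~≡ (lin (s ∷ t ∷ a ∷ []) (λ s t a → let d = t ⊕ s in ⊢ t ⊕ (d ⊕ (d ⊕ a)) ≈ d ⊕ d ⊕ (t ⊕ a)))))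

    shift′ : ∀ {j} → a ≤ j → j ≤ d + a → S j (d + d + j)
    shift′ {j} a≤j j≤V with m≤n⇒∃[o]m+o≡n a≤j
    ... | t , refl with m≤n⇒∃[o]m+o≡n j≤V
    ... | s , eq = subst (λ j → S j (d + d + j)) (+-comm t a)
      (shift t s (lin (a ∷ t ∷ s ∷ d ∷ []) (λ a t s d → a ⊕ t ⊕ s ≈ d ⊕ a ⇒ ⊢ t ⊕ s ≈ d) eq))

    at-cut : ∀ p {j} → a ≤ j → j ≤ d + a → S j (cut p (d + d) j)
    at-cut p {j} a≤j j≤V with j <? p
    ... | yes _ = ~refl
    ... | no _ = shift′ a≤j j≤V

    -- The three layers over [a,d+a] are related to one another by the reflections, so the section
    -- may change from the first layer to the third at any `p` in that interval. Lifting a walk will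
    -- need both extreme choices of `p`.
    zigzag-cover : ∀ p → a ≤ p → p ≤ d + a → ∀ i → S i (cut p (d + d) (bend (d + a) d a i))
    zigzag-cover p a≤p p≤V i with region (d + a) d i
    ... | lo i<V rewrite bend-lo (d + a) d a i<V with i <? a
    ...   | yes i<a rewrite cut-< {p} {d + d} (≤-trans i<a a≤p) = ~refl
    ...   | no i≮a = at-cut p (≮⇒≥ i≮a) (<⇒≤ i<V)
    zigzag-cover p a≤p p≤V i | md s t refl refl rewrite bend-md (t + s + a) (t + s) a s t refl =
      ~trans (~sym (refl-V s (t + a) (lin (s ∷ t ∷ a ∷ []) (λ s t a → ⊢ s ⊕ (t ⊕ a) ≈ t ⊕ s ⊕ a)) (m≤n+m s t)))
             (at-cut p (m≤n+m a t) (+-monoˡ-≤ a (m≤m+n t s)))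
    zigzag-cover p a≤p p≤V i | hi s refl rewrite bend-hi (d + a) d a (suc s) = ~trans (~≡ same) back
      where
      j = suc s + a
      same : suc s + (d + (d + a)) ≡ d + d + j
      same = lin (s ∷ d ∷ a ∷ []) (λ s d a → ⊢ # 1 ⊕ (s ⊕ (d ⊕ (d ⊕ a))) ≈ d ⊕ d ⊕ (# 1 ⊕ (s ⊕ a)))
      back : S (d + d + j) (cut p (d + d) j)
      back with j <? p
      ... | yes j<p = ~sym (shift′ (m≤n+m a (suc s)) (≤-trans (<⇒≤ j<p) p≤V))
      ... | no _ = ~refl

open Cover

-- The covering lemmas for equality of letters show that folding preserves letters. The length drops
-- by d for a prefix or suffix and by 2d for a zigzag.
shape-retract : ∀ {w M d} → 0 < d → Shape w M d → Retract w M
shape-retract {w} {_} {d} 0<d (prefix b refl pal) = record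
  { M′ = b + d ; M′<M = lin (b ∷ d ∷ []) (λ b d → # 1 ≼ d ⇒ ⊢ # 1 ⊕ (b ⊕ d) ≼ b ⊕ (d ⊕ d)) 0<d
  ; r = bend 0 d 0 ; e = cut 0 d
  ; r-bound = bound
  ; e-bound = λ j j≤ → ≤-trans (cut-bound 0 d j≤) (≤-reflexive (lin (b ∷ d ∷ []) (λ b d → ⊢ d ⊕ (b ⊕ d) ≈ b ⊕ (d ⊕ d))))
  ; r∘e = λ j _ → trans (cong (bend 0 d 0) (trans (cut-≥ {0} {d} z≤n)
                      (lin (d ∷ j ∷ []) (λ d j → ⊢ d ⊕ j ≈ j ⊕ (d ⊕ # 0)))))
                    (trans (bend-hi 0 d 0 j) (+-identityʳ j))
  ; r-step = λ i _ → bend-step 0 d 0 (inj₁ refl) i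
  ; w∘e∘r = λ i _ → prefix-cover (On.isEquivalence w isEquivalence) d pal i }
  where
  bound : ∀ i → i ≤ b + (d + d) → bend 0 d 0 i ≤ b + d
  bound i i≤M with region 0 d i
  ... | md s t refl refl rewrite bend-md 0 (t + s) 0 s t refl =
    lin (b ∷ s ∷ t ∷ []) (λ b s t → ⊢ t ⊕ # 0 ≼ b ⊕ (t ⊕ s))
  ... | hi s refl rewrite bend-hi 0 d 0 (suc s) =
    lin (b ∷ s ∷ d ∷ []) (λ b s d → # 1 ⊕ (s ⊕ (d ⊕ # 0)) ≼ b ⊕ (d ⊕ d) ⇒ ⊢ # 1 ⊕ (s ⊕ # 0) ≼ b ⊕ d) i≤M
shape-retract {w} {_} {d} 0<d (suffix a refl pal) = record
  { M′ = d + a ; M′<M = lin (d ∷ a ∷ []) (λ d a → # 1 ≼ d ⇒ ⊢ # 1 ⊕ (d ⊕ a) ≼ d ⊕ (d ⊕ a)) 0<d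
  ; r = bend (d + a) d a ; e = λ j → j
  ; r-bound = bound
  ; e-bound = λ j j≤ → ≤-trans j≤ (m≤n+m (d + a) d)
  ; r∘e = back
  ; r-step = λ i _ → bend-step (d + a) d a (inj₂ refl) i
  ; w∘e∘r = λ i i≤M → suffix-cover (On.isEquivalence w isEquivalence) d a pal i i≤M }
  where
  bound : ∀ i → i ≤ d + (d + a) → bend (d + a) d a i ≤ d + a
  bound i i≤M with region (d + a) d i
  ... | lo i<V rewrite bend-lo (d + a) d a i<V = <⇒≤ i<V
  ... | md s t refl refl rewrite bend-md (t + s + a) (t + s) a s t refl = +-monoˡ-≤ a (m≤m+n t s)
  ... | hi s refl = ⊥-elim (m+1+n≰m _ (subst (_≤ d + (d + a)) (+-comm (suc s) _) i≤M))
  back : ∀ j → j ≤ d + a → bend (d + a) d a j ≡ j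
  back j j≤V with m≤n⇒m<n∨m≡n j≤V
  ... | inj₁ j<V = bend-lo (d + a) d a j<V
  ... | inj₂ refl = bend-md (d + a) d a 0 d (+-identityʳ d)
shape-retract {w} {_} {d} 0<d (zigzag a b refl palV palW) = record
  { M′ = b + (d + a)
  ; M′<M = lin (b ∷ d ∷ a ∷ []) (λ b d a → # 1 ≼ d ⇒ ⊢ # 1 ⊕ (b ⊕ (d ⊕ a)) ≼ b ⊕ (d ⊕ (d ⊕ (d ⊕ a)))) 0<d
  ; r = bend (d + a) d a ; e = cut a (d + d)
  ; r-bound = bound
  ; e-bound = λ j j≤ → ≤-trans (cut-bound a (d + d) j≤)
      (≤-reflexive (lin (b ∷ d ∷ a ∷ []) (λ b d a → ⊢ d ⊕ d ⊕ (b ⊕ (d ⊕ a)) ≈ b ⊕ (d ⊕ (d ⊕ (d ⊕ a))))))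
  ; r∘e = λ j _ → back j
  ; r-step = λ i _ → bend-step (d + a) d a (inj₂ refl) i
  ; w∘e∘r = λ i _ → zigzag-cover (On.isEquivalence w isEquivalence) d a palV palW a ≤-refl (m≤n+m a d) i }
  where
  bound : ∀ i → i ≤ b + (d + (d + (d + a))) → bend (d + a) d a i ≤ b + (d + a)
  bound i i≤M with region (d + a) d i
  ... | lo i<V rewrite bend-lo (d + a) d a i<V = ≤-trans (<⇒≤ i<V) (m≤n+m (d + a) b)
  ... | md s t refl refl rewrite bend-md (t + s + a) (t + s) a s t refl =
    lin (a ∷ b ∷ s ∷ t ∷ []) (λ a b s t → ⊢ t ⊕ a ≼ b ⊕ (t ⊕ s ⊕ a))
  ... | hi s refl rewrite bend-hi (d + a) d a (suc s) =
    lin (a ∷ b ∷ d ∷ s ∷ []) (λ a b d s →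
      # 1 ⊕ (s ⊕ (d ⊕ (d ⊕ a))) ≼ b ⊕ (d ⊕ (d ⊕ (d ⊕ a))) ⇒ ⊢ # 1 ⊕ (s ⊕ a) ≼ b ⊕ (d ⊕ a)) i≤M
  back : ∀ j → bend (d + a) d a (cut a (d + d) j) ≡ j
  back j with j <? a
  ... | yes j<a = bend-lo (d + a) d a (≤-trans j<a (m≤n+m a d))
  ... | no j≮a with m≤n⇒∃[o]m+o≡n (≮⇒≥ j≮a)
  ... | t , refl = trans (cong (bend (d + a) d a)
      (lin (a ∷ d ∷ t ∷ []) (λ a d t → ⊢ d ⊕ d ⊕ (a ⊕ t) ≈ t ⊕ (d ⊕ (d ⊕ a)))))
      (trans (bend-hi (d + a) d a t) (+-comm t a))

squash : ℕ → ℕ → ℕ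
squash x i with i <? suc x
... | yes _ = i
... | no _ = pred i

module _ {x : ℕ} where

  squash-≤ : ∀ {i} → i ≤ x → squash x i ≡ i
  squash-≤ {i} i≤x with i <? suc x
  ... | yes _ = refl
  ... | no i≮ = contradiction (s≤s i≤x) i≮

  squash-suc : ∀ {j} → x ≤ j → squash x (suc j) ≡ j
  squash-suc {j} x≤j with suc j <? suc x
  ... | yes (s≤s j<x) = contradiction x≤j (<⇒≱ j<x)
  ... | no _ = refl

  squash-step : ∀ i → Near (squash x (suc i)) (squash x i)
  squash-step i with <-cmp i x
  ... | tri< i<x _ _ rewrite squash-≤ i<x | squash-≤ (<⇒≤ i<x) = near-suc i
  ... | tri≈ _ refl _ rewrite squash-suc {i} ≤-refl | squash-≤ {i} ≤-refl = near-refl i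
  squash-step (suc i) | tri> _ _ (s≤s x≤i)
    rewrite squash-suc (≤-trans x≤i (n≤1+n i)) | squash-suc x≤i = near-suc i

  module _ {S : ℕ → ℕ → Set} (E : IsEquivalence S) (stutter : S x (suc x)) where
    open IsEquivalence E renaming (refl to ~refl; sym to ~sym; trans to ~trans; reflexive to ~≡)

    squash-cover : ∀ i → S i (cut x 1 (squash x i))
    squash-cover i with <-cmp i x
    ... | tri< i<x _ _ rewrite squash-≤ (<⇒≤ i<x) | cut-< {x} {1} i<x = ~refl
    ... | tri≈ _ refl _ rewrite squash-≤ {i} ≤-refl | cut-≥ {i} {1} ≤-refl = stutter
    squash-cover (suc i) | tri> _ _ (s≤s x≤i) rewrite squash-suc x≤i | cut-≥ {x} {1} x≤i = ~refl

stutter-retract : ∀ {w M x} → x ≤ M → w x ≡ w (suc x) → Retract w (suc M)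
stutter-retract {w} {M} {x} x≤M eq = record
  { M′ = M ; M′<M = ≤-refl ; r = squash x ; e = cut x 1
  ; r-bound = bound ; e-bound = λ j j≤M → cut-bound x 1 j≤M
  ; r∘e = λ j _ → back j
  ; r-step = λ i _ → squash-step i
  ; w∘e∘r = λ i _ → squash-cover (On.isEquivalence w isEquivalence) eq i }
  where
  bound : ∀ i → i ≤ suc M → squash x i ≤ M
  bound i i≤ with i <? suc x
  ... | yes (s≤s i≤x) = ≤-trans i≤x x≤M
  ... | no _ = pred-mono-≤ i≤
  back : ∀ j → squash x (cut x 1 j) ≡ j
  back j with j <? x
  ... | yes j<x = squash-≤ (<⇒≤ j<x)
  ... | no j≮x = squash-suc (≮⇒≥ j≮x)

-- Walks and their turning points

Extreme : ℕ → ℕ → Set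
Extreme N y = y ≡ 0 ⊎ y ≡ N

-- As steps are at most 1, reaching both ends 0 and `N` amounts to surjectivity, and it is easier to
-- preserve when part of the domain is cut away.
record Walk (M N : ℕ) (f : ℕ → ℕ) : Set where
  constructor walk
  field
    step : ∀ i → i < M → Near (f (suc i)) (f i)
    bound : ∀ i → i ≤ M → f i ≤ N
    hit : ∀ y → Extreme N y → ∃ λ x → x ≤ M × f x ≡ y

-- The block [p,p+k) can go if `f` agrees at `p` and `k + p`, so that the remains fit together, and
-- if each end of the target reached in the block is also reached outside it. A block at the very
-- start needs no fitting.
walk-cut : ∀ {M N f} → Walk M N f → ∀ p k M′ → M ≡ k + M′ → p ≤ M′ → p ≡ 0 ⊎ f p ≡ f (k + p) →
           (∀ x → x ≤ M → Extreme N (f x) → p ≤ x → x < k + p →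
              ∃ λ x′ → x′ ≤ M × (x′ < p ⊎ k + p ≤ x′) × f x′ ≡ f x) →
           Walk M′ N (λ j → f (cut p k j))
walk-cut {N = N} {f} (walk step bound hit) p k M′ refl p≤M′ join keep =
  walk step′ (λ j j≤M′ → bound _ (cut-bound p k j≤M′)) hit′
  where
  step′ : ∀ j → j < M′ → Near (f (cut p k (suc j))) (f (cut p k j))
  step′ j j<M′ with <-cmp (suc j) p
  ... | tri< 1+j<p _ _ rewrite cut-< {p} {k} 1+j<p | cut-< {p} {k} (<⇒≤ 1+j<p) =
    step j (≤-trans j<M′ (m≤n+m M′ k))
  ... | tri> _ _ (s≤s p≤j)
    rewrite cut-≥ {p} {k} (≤-trans p≤j (n≤1+n j)) | cut-≥ {p} {k} p≤j | +-suc k j =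
    step (k + j) (subst (_≤ k + M′) (+-suc k j) (+-monoʳ-≤ k j<M′))
  -- The step across the gap has the same values as the old step into `p`.
  step′ j j<M′ | tri≈ _ refl _
    rewrite cut-≥ {suc j} {k} ≤-refl | cut-< {suc j} {k} ≤-refl | sym ([ (λ ()) , (λ eq → eq) ]′ join) =
    step j (≤-trans j<M′ (m≤n+m M′ k))

  place : ∀ {y} x → x ≤ k + M′ → f x ≡ y → x < p ⊎ k + p ≤ x → ∃ λ j → j ≤ M′ × f (cut p k j) ≡ y
  place x x≤M eq (inj₁ x<p) = x , ≤-trans (<⇒≤ x<p) p≤M′ , trans (cong f (cut-< x<p)) eq
  place x x≤M eq (inj₂ k+p≤x) with m≤n⇒∃[o]m+o≡n k+p≤x
  ... | o , refl = p + o , +-cancelˡ-≤ k _ _ (subst (_≤ k + M′) (+-assoc k p o) x≤M) ,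
    trans (cong f (trans (cut-≥ (m≤m+n p o)) (sym (+-assoc k p o)))) eq

  hit′ : ∀ y → Extreme N y → ∃ λ j → j ≤ M′ × f (cut p k j) ≡ y
  hit′ y ext with hit y ext
  ... | x , x≤M , refl with x <? p
  ... | yes x<p = place x x≤M refl (inj₁ x<p)
  ... | no x≮p with x <? k + p
  ... | no x≮ = place x x≤M refl (inj₂ (≮⇒≥ x≮))
  ... | yes x< with keep x x≤M ext (≮⇒≥ x≮p) x<
  ... | x′ , x′≤M , kept , eq = place x′ x′≤M eq kept

-- Written additively, so that descending does not involve truncated subtraction.
data Straight (f : ℕ → ℕ) (k L : ℕ) : Set where
  up   : (∀ s → s ≤ L → f (s + k) ≡ s + f k) → Straight f k L
  down : (∀ s → s ≤ L → s + f (s + k) ≡ f k) → Straight f k L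

data Node (f : ℕ → ℕ) (M : ℕ) : ℕ → Set where
  start : Node f M 0
  end   : Node f M M
  turn  : ∀ {c} → 0 < c → c < M → f (pred c) ≡ f (suc c) → Node f M c

node-≤ : ∀ {f M c} → Node f M c → c ≤ M
node-≤ start = z≤n
node-≤ end = ≤-refl
node-≤ (turn _ c<M _) = <⇒≤ c<M

node? : ∀ f M c → c ≤ M → Dec (Node f M c)
node? f M zero _ = yes start
node? f M (suc c) c≤M with suc c ≟ M
... | yes refl = yes end
... | no c≢M with f c ≟ f (suc (suc c))
... | yes eq = yes (turn (s≤s z≤n) (≤∧≢⇒< c≤M c≢M) eq)
... | no neq = no λ { end → c≢M refl ; (turn _ _ eq) → neq eq }

Clear : (ℕ → ℕ) → ℕ → ℕ → ℕ → Set
Clear f M x y = ∀ z → x < z → z < y → ¬ Node f M z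

Strict : ℕ → (ℕ → ℕ) → Set
Strict M f = ∀ i → i < M → f (suc i) ≡ suc (f i) ⊎ f i ≡ suc (f (suc i))

module _ {M : ℕ} {f : ℕ → ℕ} (strict : Strict M f) where

  -- Induction on `L`: two consecutive steps in opposite directions would make a turning point
  -- inside the clear interval.
  straight : ∀ k L → L + k ≤ M → Clear f M k (L + k) → Straight f k L
  straight k zero _ _ = up λ { zero z≤n → refl }
  straight k (suc zero) ≤M _ with strict k ≤M
  ... | inj₁ eq = up λ { zero _ → refl ; (suc zero) _ → eq ; (suc (suc _)) (s≤s ()) }
  ... | inj₂ eq = down λ { zero _ → refl ; (suc zero) _ → sym eq ; (suc (suc _)) (s≤s ()) }
  straight k (suc (suc L)) ≤M clear
    with straight k (suc L) (<⇒≤ ≤M) (λ z p q → clear z p (≤-trans q (n≤1+n _))) | strict (suc L + k) ≤M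
  ... | up h | inj₁ eq = up extend
    where
    extend : ∀ s → s ≤ suc (suc L) → f (s + k) ≡ s + f k
    extend s s≤ with m≤n⇒m<n∨m≡n s≤
    ... | inj₁ (s≤s s≤L) = h s s≤L
    ... | inj₂ refl = trans eq (cong suc (h (suc L) ≤-refl))
  ... | down h | inj₂ eq = down extend
    where
    extend : ∀ s → s ≤ suc (suc L) → s + f (s + k) ≡ f k
    extend s s≤ with m≤n⇒m<n∨m≡n s≤
    ... | inj₁ (s≤s s≤L) = h s s≤L
    ... | inj₂ refl = trans (cong suc (trans (sym (+-suc L _)) (cong (L +_) (sym eq)))) (h (suc L) ≤-refl)
  ... | up h | inj₂ eq = ⊥-elim (clear (suc L + k) (s≤s (m≤n+m k L)) ≤-refl
          (turn (s≤s z≤n) ≤M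
            (lin (L ∷ f k ∷ f (L + k) ∷ f (suc L + k) ∷ f (suc (suc L) + k) ∷ [])
              (λ L x y z t → y ≈ L ⊕ x ⇒ z ≈ # 1 ⊕ (L ⊕ x) ⇒ z ≈ # 1 ⊕ t ⇒ ⊢ y ≈ t)
              (h L (n≤1+n L)) (h (suc L) ≤-refl) eq)))
  ... | down h | inj₁ eq = ⊥-elim (clear (suc L + k) (s≤s (m≤n+m k L)) ≤-refl
          (turn (s≤s z≤n) ≤M
            (lin (L ∷ f k ∷ f (L + k) ∷ f (suc L + k) ∷ f (suc (suc L) + k) ∷ [])
              (λ L x y z t → L ⊕ y ≈ x ⇒ # 1 ⊕ (L ⊕ z) ≈ x ⇒ t ≈ # 1 ⊕ z ⇒ ⊢ y ≈ t)
              (h L (n≤1+n L)) (h (suc L) ≤-refl) eq)))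

  -- With no other node nearby, `f` runs straight into `c` and straight out of it in the opposite
  -- direction.
  reflect-turn : ∀ s k c → s + k ≡ c → s + c ≤ M → f (pred c) ≡ f (suc c) →
                 Clear f M k c → Clear f M c (s + c) → f k ≡ f (s + c)
  reflect-turn zero k c refl _ _ _ _ = refl
  reflect-turn (suc s) k .(suc s + k) refl ≤M eq clear clear′
    with straight k (suc s) (≤-trans (m≤n+m (suc s + k) (suc s)) ≤M) clear
       | straight (suc s + k) (suc s) ≤M clear′
  -- Keeping the same direction would put `f (pred c)` and `f (suc c)` two apart.
  ... | up h | up h′ = ⊥-elim (lin (s ∷ f k ∷ f (s + k) ∷ f (suc s + k) ∷ f (suc (suc s + k)) ∷ [])
          (λ s x y z t → y ≈ s ⊕ x ⇒ z ≈ # 1 ⊕ (s ⊕ x) ⇒ t ≈ # 1 ⊕ z ⇒ y ≈ t ⇒ ⊢ false′)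
          (h s (n≤1+n s)) (h (suc s) ≤-refl) (h′ 1 (s≤s z≤n)) eq)
  ... | down h | down h′ = ⊥-elim (lin (s ∷ f k ∷ f (s + k) ∷ f (suc s + k) ∷ f (suc (suc s + k)) ∷ [])
          (λ s x y z t → s ⊕ y ≈ x ⇒ # 1 ⊕ (s ⊕ z) ≈ x ⇒ # 1 ⊕ t ≈ z ⇒ y ≈ t ⇒ ⊢ false′)
          (h s (n≤1+n s)) (h (suc s) ≤-refl) (h′ 1 (s≤s z≤n)) eq)
  ... | up h | down h′ = lin (s ∷ f k ∷ f (suc s + k) ∷ f (suc s + (suc s + k)) ∷ [])
          (λ s x z t → z ≈ # 1 ⊕ (s ⊕ x) ⇒ # 1 ⊕ (s ⊕ t) ≈ z ⇒ ⊢ x ≈ t)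
          (h (suc s) ≤-refl) (h′ (suc s) ≤-refl)
  ... | down h | up h′ = lin (s ∷ f k ∷ f (suc s + k) ∷ f (suc s + (suc s + k)) ∷ [])
          (λ s x z t → # 1 ⊕ (s ⊕ z) ≈ x ⇒ t ≈ # 1 ⊕ (s ⊕ z) ⇒ ⊢ x ≈ t)
          (h (suc s) ≤-refl) (h′ (suc s) ≤-refl)

  -- Moving straight on through 0 or `N` would leave [0,N].
  extreme-node : ∀ {N} → (∀ i → i ≤ M → f i ≤ N) → ∀ x → x ≤ M → Extreme N (f x) → Node f M x
  extreme-node bound zero _ _ = start
  extreme-node {N} bound (suc x) x≤M ext with suc x ≟ M
  ... | yes refl = end
  ... | no x≢M = turn (s≤s z≤n) x<M (go ext (strict x x≤M) (strict (suc x) x<M))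
    where
    x<M = ≤∧≢⇒< x≤M x≢M
    p = f x
    q = f (suc x)
    r = f (suc (suc x))
    go : Extreme N q → q ≡ suc p ⊎ p ≡ suc q → r ≡ suc q ⊎ q ≡ suc r → p ≡ r
    go _ (inj₁ e) (inj₂ e′) = lin (p ∷ q ∷ r ∷ []) (λ p q r → q ≈ # 1 ⊕ p ⇒ q ≈ # 1 ⊕ r ⇒ ⊢ p ≈ r) e e′
    go _ (inj₂ e) (inj₁ e′) = trans e (sym e′)
    go (inj₁ z) (inj₁ e) (inj₁ e′) = contradiction (trans (sym z) e) λ ()
    go (inj₂ z) (inj₁ e) (inj₁ e′) = ⊥-elim (lin (q ∷ r ∷ N ∷ []) (λ q r N → q ≈ N ⇒ r ≈ # 1 ⊕ q ⇒ r ≼ N ⇒ ⊢ false′)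
      z e′ (bound (suc (suc x)) x<M))
    go (inj₁ z) (inj₂ e) (inj₂ e′) = contradiction (trans (sym z) e′) λ ()
    go (inj₂ z) (inj₂ e) (inj₂ e′) = ⊥-elim (lin (q ∷ p ∷ N ∷ []) (λ q r N → q ≈ N ⇒ r ≈ # 1 ⊕ q ⇒ r ≼ N ⇒ ⊢ false′)
      z e (bound x (≤-trans (n≤1+n x) x≤M)))

-- The factor of w from i to j is a palindrome; its length may be even.
SegPal : (ℕ → ℕ) → ℕ → ℕ → Set
SegPal w i j = ∀ t t′ → t + (t′ + i) ≡ j → w (t + i) ≡ w (t′ + i)

-- Offsets adding up to the length of the segment are symmetric about `c`; by symmetry the smaller
-- one may be taken first, and it lies on the left of the centre.
pal-seg : ∀ {w c d} → Pal w c d → ∀ s k → s + k ≡ c → s ≤ d → SegPal w k (s + c)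
pal-seg {w} {c} {d} pal s k refl s≤d t t′ eq = [ half t t′ eq , (λ t′≤t → sym (half t′ t swapped t′≤t)) ]′ (≤-total t t′)
  where
  swapped : t′ + (t + k) ≡ s + (s + k)
  swapped = trans (lin (t ∷ t′ ∷ k ∷ []) (λ t t′ k → ⊢ t′ ⊕ (t ⊕ k) ≈ t ⊕ (t′ ⊕ k))) eq

  half : ∀ t t′ → t + (t′ + k) ≡ s + (s + k) → t ≤ t′ → w (t + k) ≡ w (t′ + k)
  half t t′ eq t≤t′ with t ≤? s
  ... | no p = ⊥-elim (lin (s ∷ t ∷ t′ ∷ k ∷ [])
        (λ s t t′ k → # 1 ⊕ s ≼ t ⇒ # 1 ⊕ s ≼ t′ ⇒ t ⊕ (t′ ⊕ k) ≈ s ⊕ (s ⊕ k) ⇒ ⊢ false′)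
        (≰⇒> p) (≤-trans (≰⇒> p) t≤t′) eq)
  ... | yes t≤s with m≤n⇒∃[o]m+o≡n t≤s
  ...   | o , refl = trans
    (pal o (t + k) (lin (o ∷ t ∷ k ∷ []) (λ o t k → ⊢ o ⊕ (t ⊕ k) ≈ t ⊕ o ⊕ k)) (≤-trans (m≤n+m o t) s≤d))
    (cong w (lin (o ∷ t ∷ t′ ∷ k ∷ [])
      (λ o t t′ k → t ⊕ (t′ ⊕ k) ≈ t ⊕ o ⊕ (t ⊕ o ⊕ k) ⇒ ⊢ o ⊕ (t ⊕ o ⊕ k) ≈ t′ ⊕ k) eq))

seg-pal : ∀ {w d i j} → SegPal w i j → d + (d + i) ≡ j → Pal w (d + i) d
seg-pal {w} {d} {i} seg refl s k eq s≤d with m≤n⇒∃[o]m+o≡n s≤d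
... | t , refl = trans (cong w e₁) (trans (seg t (s + (s + t)) e₂) (cong w e₃))
  where
  e₁ : k ≡ t + i
  e₁ = lin (s ∷ k ∷ t ∷ i ∷ []) (λ s k t i → s ⊕ k ≈ s ⊕ t ⊕ i ⇒ ⊢ k ≈ t ⊕ i) eq
  e₂ : t + (s + (s + t) + i) ≡ s + t + (s + t + i)
  e₂ = lin (s ∷ t ∷ i ∷ []) (λ s t i → ⊢ t ⊕ (s ⊕ (s ⊕ t) ⊕ i) ≈ s ⊕ t ⊕ (s ⊕ t ⊕ i))
  e₃ : s + (s + t) + i ≡ s + (s + t + i)
  e₃ = +-assoc s (s + t) i

fold-retract : ∀ {w M d} → Fold w M d → Retract w M
fold-retract φ = shape-retract (Fold.0<d φ) (shape φ)

mirror-bound : ∀ {w M d c} → Mirror w M d c → c ≤ M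
mirror-bound start = z≤n
mirror-bound end = ≤-refl
mirror-bound {d = d} (mid _ d+c≤M _) = ≤-trans (m≤n+m _ d) d+c≤M

-- A straight stretch of `f` copies a segment of `w` into `u`, possibly reversed, and the reversal
-- of a palindrome is a palindrome.
straight-seg : ∀ {u w f : ℕ → ℕ} k L → (∀ s → s ≤ L → u (f (s + k)) ≡ w (s + k)) →
  SegPal w k (L + k) → Straight f k L →
  (f (L + k) ≡ L + f k × SegPal u (f k) (f (L + k))) ⊎
  (f k ≡ L + f (L + k) × SegPal u (f (L + k)) (f k))
straight-seg {u} {w} {f} k L fw seg (up h) = inj₁ (h L ≤-refl , λ t t′ eq →
  let sum = trans eq (h L ≤-refl)
      t≤L = lin (t ∷ t′ ∷ f k ∷ L ∷ []) (λ t t′ x L → t ⊕ (t′ ⊕ x) ≈ L ⊕ x ⇒ ⊢ t ≼ L) sum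
      t′≤L = lin (t ∷ t′ ∷ f k ∷ L ∷ []) (λ t t′ x L → t ⊕ (t′ ⊕ x) ≈ L ⊕ x ⇒ ⊢ t′ ≼ L) sum
  in trans (cong u (sym (h t t≤L))) (trans (fw t t≤L)
      (trans (seg t t′ (lin (t ∷ t′ ∷ f k ∷ L ∷ k ∷ [])
               (λ t t′ x L k → t ⊕ (t′ ⊕ x) ≈ L ⊕ x ⇒ ⊢ t ⊕ (t′ ⊕ k) ≈ L ⊕ k) sum))
        (trans (sym (fw t′ t′≤L)) (cong u (h t′ t′≤L))))))
straight-seg {u} {w} {f} k L fw seg (down h) = inj₂ (sym (h L ≤-refl) , λ t t′ eq →
  let y = f (L + k)
      sum = trans eq (sym (h L ≤-refl))
      t≤L = lin (t ∷ t′ ∷ y ∷ L ∷ []) (λ t t′ x L → t ⊕ (t′ ⊕ x) ≈ L ⊕ x ⇒ ⊢ t ≼ L) sum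
      t′≤L = lin (t ∷ t′ ∷ y ∷ L ∷ []) (λ t t′ x L → t ⊕ (t′ ⊕ x) ≈ L ⊕ x ⇒ ⊢ t′ ≼ L) sum
      at : ∀ a b → b + (a + y) ≡ f k → b ≤ L → a + y ≡ f (b + k)
      at a b eq b≤L = lin (a ∷ b ∷ y ∷ f k ∷ f (b + k) ∷ [])
        (λ a b y x z → b ⊕ (a ⊕ y) ≈ x ⇒ b ⊕ z ≈ x ⇒ ⊢ a ⊕ y ≈ z) eq (h b b≤L)
      eq′ = trans (lin (t ∷ t′ ∷ y ∷ []) (λ t t′ y → ⊢ t′ ⊕ (t ⊕ y) ≈ t ⊕ (t′ ⊕ y))) eq
  in trans (cong u (at t t′ eq′ t′≤L)) (trans (fw t′ t′≤L)
      (trans (sym (seg t t′ (lin (t ∷ t′ ∷ y ∷ L ∷ k ∷ [])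
               (λ t t′ x L k → t ⊕ (t′ ⊕ x) ≈ L ⊕ x ⇒ ⊢ t ⊕ (t′ ⊕ k) ≈ L ⊕ k) sum)))
        (trans (sym (fw t t≤L)) (cong u (sym (at t′ t eq t≤L)))))))

-- Decidability of folds and the choice of a minimal radius

pal? : ∀ w c d → d ≤ c → Dec (Pal w c d)
pal? w c d d≤c = map′ to from (allUpTo? (λ s → w (c ∸ s) ≟ w (s + c)) (suc d))
  where
  to : (∀ {s} → s < suc d → w (c ∸ s) ≡ w (s + c)) → Pal w c d
  to h s k s+k≡c s≤d = trans (cong w (sym (trans (cong (_∸ s) (sym s+k≡c)) (m+n∸m≡n s k)))) (h (s≤s s≤d))
  from : Pal w c d → ∀ {s} → s < suc d → w (c ∸ s) ≡ w (s + c)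
  from pal (s≤s s≤d) = pal _ _ (m+[n∸m]≡n (≤-trans s≤d d≤c)) s≤d

mirror? : ∀ w M d c → Dec (Mirror w M d c)
mirror? w M d c with c ≟ 0 | c ≟ M | d ≤? c | d + c ≤? M
... | yes refl | _ | _ | _ = yes start
... | no _ | yes refl | _ | _ = yes end
... | no c≢0 | no c≢M | no d≰c | _ = no λ { start → c≢0 refl ; end → c≢M refl ; (mid d≤c _ _) → d≰c d≤c }
... | no c≢0 | no c≢M | yes _ | no d+c≰M = no λ { start → c≢0 refl ; end → c≢M refl ; (mid _ d+c≤M _) → d+c≰M d+c≤M }
... | no c≢0 | no c≢M | yes d≤c | yes d+c≤M = map′ (mid d≤c d+c≤M)
  (λ { start → contradiction refl c≢0 ; end → contradiction refl c≢M ; (mid _ _ pal) → pal }) (pal? w c d d≤c)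

fold? : ∀ w M d → Dec (Fold w M d)
fold? w M d = map′
  (λ { (0<d , d<M , V , _ , fits , l , r) → fold V 0<d d<M fits l r })
  (λ { (fold V 0<d d<M fits l r) → 0<d , d<M , V , s≤s (mirror-bound l) , fits , l , r })
  (0 <? d ×-dec d <? M ×-dec
    anyUpTo? (λ V → d + V ≤? M ×-dec mirror? w M d V ×-dec mirror? w M d (d + V)) (suc M))

least : ∀ {P : ℕ → Set} → (∀ d → Dec (P d)) → ∀ K →
        (∃ λ d → P d × (∀ e → e < d → ¬ P e)) ⊎ (∀ e → e < K → ¬ P e)
least P? zero = inj₂ λ _ ()
least P? (suc K) with least P? K
... | inj₁ found = inj₁ found
... | inj₂ none with P? K
... | yes p = inj₁ (K , p , none)
... | no ¬p = inj₂ λ e e<1+K → [ none e , (λ { refl → ¬p }) ]′ (m≤n⇒m<n∨m≡n (≤-pred e<1+K))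

-- Rigid words and the lifting of walks along retractions

Apart : ℕ → ℕ → ℕ → Set
Apart d x y = x ≡ d + y ⊎ y ≡ d + x

-- `rigid` stands for primitivity and `~` for the equivalence generated by the defects. Only two
-- facts about `~` are assumed: related positions carry equal letters, and the ends of a palindromic
-- factor are related.
module Rigid {N : ℕ} {u : ℕ → ℕ} (rigid : ¬ Retract u N)
             {_~_ : ℕ → ℕ → Set} (E : IsEquivalence _~_)
             (~⇒≡ : ∀ {i j} → i ~ j → u i ≡ u j)
             (pal~ : ∀ i j → i < j → j ≤ N → SegPal u i j → i ~ j) where
  open IsEquivalence E renaming (refl to ~refl; sym to ~sym; trans to ~trans; reflexive to ~≡)

  no-fold : ∀ d → ¬ Fold u N d
  no-fold d φ = rigid (fold-retract φ)

  no-stutter : ∀ x → x < N → ¬ u x ≡ u (suc x)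
  no-stutter x (s≤s x≤N) eq = rigid (stutter-retract x≤N eq)

  -- Equality of `f′ ∘ r` and `f` would be too much: where `f` passes straight over a mirror, the
  -- fold identifies positions whose images are only related.
  Lifts : ∀ {w M} → Retract w M → Set
  Lifts {w} {M} R = ∀ f → Walk M N f → (∀ i → i ≤ M → u (f i) ≡ w i) →
    ∃ λ f′ → Walk (Retract.M′ R) N f′ × (∀ i → i ≤ M → f′ (Retract.r R i) ~ f i)

  stutter-lifts : ∀ {w M x} (x≤M : x ≤ M) (eq : w x ≡ w (suc x)) → Lifts (stutter-retract {w} x≤M eq)
  stutter-lifts {w} {M} {x} x≤M eq f W fw =
    (λ j → f (cut x 1 j)) , walk-cut W x 1 M refl x≤M (inj₂ same) keep ,
    λ i _ → ~sym (squash-cover (On.isEquivalence f E) (~≡ same) i)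
    where
    -- If `f` moved here, `u` would have two equal adjacent letters.
    same : f x ≡ f (suc x)
    same with Walk.step W x (s≤s x≤M) | <-cmp (f x) (f (suc x))
    ... | _ | tri≈ _ e _ = e
    ... | p , _ | tri< l _ _ = ⊥-elim (no-stutter (f x) (≤-trans l (Walk.bound W (suc x) (s≤s x≤M)))
          (trans (fw x (≤-trans x≤M (n≤1+n M)))
            (trans eq (trans (sym (fw (suc x) (s≤s x≤M))) (cong u (≤-antisym p l))))))
    ... | _ , q | tri> _ _ l = ⊥-elim (no-stutter (f (suc x)) (≤-trans l (Walk.bound W x (≤-trans x≤M (n≤1+n M))))
          (trans (fw (suc x) (s≤s x≤M))
            (trans (sym eq) (trans (sym (fw x (≤-trans x≤M (n≤1+n M)))) (cong u (≤-antisym q l))))))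
    keep : ∀ y → y ≤ suc M → Extreme N (f y) → x ≤ y → y < suc x →
           ∃ λ y′ → y′ ≤ suc M × (y′ < x ⊎ suc x ≤ y′) × f y′ ≡ f y
    keep y _ _ x≤y (s≤s y≤x) with ≤-antisym x≤y y≤x
    ... | refl = suc x , s≤s x≤M , inj₂ ≤-refl , sym same

  module OnWalk {w : ℕ → ℕ} {M : ℕ} (w-strict : ∀ i → i < M → ¬ w i ≡ w (suc i))
                {f : ℕ → ℕ} (W : Walk M N f) (fw : ∀ i → i ≤ M → u (f i) ≡ w i) where
    open Walk W

    strict : Strict M f
    strict i i<M with step i i<M | <-cmp (f i) (f (suc i))
    ... | p , _ | tri< l _ _ = inj₁ (≤-antisym p l)
    ... | _ , q | tri> _ _ l = inj₂ (≤-antisym q l)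
    ... | _ | tri≈ _ e _ =
      ⊥-elim (w-strict i i<M (trans (sym (fw i (<⇒≤ i<M))) (trans (cong u e) (fw (suc i) i<M))))

    -- The last premise excludes only the pair of ends 0, M.
    Spaced : ℕ → Set
    Spaced L = ∀ x y → Node f M x → Node f M y → x < y → y < M + x → L + x ≤ y

    -- Near an isolated turning point `f` is symmetric, hence so is `w`, which is `u ∘ f`.
    node-mirror : ∀ {L c} → Spaced L → Node f M c → Mirror w M L c
    node-mirror _ start = start
    node-mirror _ end = end
    node-mirror {L} {c} sp ν@(turn 0<c c<M eq) = mid L≤c L+c≤M λ s k s+k≡c s≤L →
      let s+c≤M = ≤-trans (+-monoˡ-≤ c s≤L) L+c≤M
          k≤M = lin (s ∷ k ∷ c ∷ M ∷ []) (λ s k c M → s ⊕ k ≈ c ⇒ # 1 ⊕ c ≼ M ⇒ ⊢ k ≼ M) s+k≡c c<M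
      in trans (sym (fw k k≤M)) (trans (cong u
           (reflect-turn strict s k c s+k≡c s+c≤M eq
             (λ z k<z z<c νz → lin (L ∷ s ∷ k ∷ c ∷ z ∷ [])
               (λ L s k c z → s ⊕ k ≈ c ⇒ s ≼ L ⇒ # 1 ⊕ k ≼ z ⇒ L ⊕ z ≼ c ⇒ ⊢ false′)
               s+k≡c s≤L k<z (sp z c νz ν z<c (≤-trans c<M (m≤m+n M z))))
             (λ z c<z z<s+c νz → lin (L ∷ s ∷ c ∷ z ∷ [])
               (λ L s c z → s ≼ L ⇒ # 1 ⊕ z ≼ s ⊕ c ⇒ L ⊕ c ≼ z ⇒ ⊢ false′)
               s≤L z<s+c (sp c z ν νz c<z (≤-<-trans (node-≤ νz) (m<m+n M 0<c))))))
           (fw (s + c) s+c≤M))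
      where
      L≤c : L ≤ c
      L≤c = subst (_≤ c) (+-identityʳ L) (sp 0 c start ν 0<c (subst (c <_) (sym (+-identityʳ M)) c<M))
      L+c≤M : L + c ≤ M
      L+c≤M = sp c M ν end c<M (m<m+n M 0<c)

    -- Induction on `L`: nodes already known to be at least `L` apart are mirrors of radius `L`, so
    -- two of them at distance exactly `L` would form a fold.
    spaced : ∀ L → (∀ e → e < L → ¬ Fold w M e) → Spaced L
    spaced zero _ x y _ _ x<y _ = <⇒≤ x<y
    spaced (suc L) min x y νx νy x<y y<M+x with spaced L (λ e e<L → min e (≤-trans e<L (n≤1+n L)))
    ... | sp with m≤n⇒m<n∨m≡n (sp x y νx νy x<y y<M+x)
    ... | inj₁ L+x<y = L+x<y
    ... | inj₂ refl = ⊥-elim (min L ≤-refl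
          (fold x (+-cancelʳ-< x 0 L x<y) (+-cancelʳ-< x L M y<M+x) (node-≤ νy)
            (node-mirror sp νx) (node-mirror sp νy)))

    module Minimal {d : ℕ} (0<d : 0 < d) (d<M : d < M) (minimal : ∀ e → e < d → ¬ Fold w M e) where

      private
        mirrors : ∀ {c} → Node f M c → Mirror w M d c
        mirrors = node-mirror (spaced d minimal)

        -- Two mirrors closer than d would be a smaller fold.
        too-close : ∀ {x y} → Mirror w M d x → Mirror w M d y → x < y → y < d + x → ⊥
        too-close {x} {y} μx μy x<y y<d+x with m≤n⇒∃[o]m+o≡n x<y
        ... | o , refl = minimal (suc o) o<d (fold x (s≤s z≤n) (≤-trans o<d (<⇒≤ d<M))
              (subst (_≤ M) swap (mirror-bound μy)) (mirror-≤ (<⇒≤ o<d) μx)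
              (mirror-≤ (<⇒≤ o<d) (subst (Mirror w M d) swap μy)))
          where
          swap : suc x + o ≡ suc o + x
          swap = cong suc (+-comm x o)
          o<d : suc o < d
          o<d = +-cancelʳ-< x (suc o) d (subst (_< d + x) swap y<d+x)

      Mid : ℕ → Set
      Mid c = d ≤ c × d + c ≤ M × Pal w c d

      mid-mirror : ∀ {c} → Mid c → Mirror w M d c
      mid-mirror (p , q , r) = mid p q r

      -- A node is itself a mirror, so one closer than `d` to another mirror would give a smaller
      -- fold.
      clear-left : ∀ {s k c} → Mirror w M d c → s + k ≡ c → s ≤ d → Clear f M k c
      clear-left {s} {k} {c} μ s+k≡c s≤d z k<z z<c νz = too-close (mirrors νz) μ z<c
        (lin (s ∷ k ∷ c ∷ d ∷ z ∷ []) (λ s k c d z → s ⊕ k ≈ c ⇒ s ≼ d ⇒ # 1 ⊕ k ≼ z ⇒ ⊢ # 1 ⊕ c ≼ d ⊕ z) s+k≡c s≤d k<z)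

      clear-right : ∀ {s c} → Mirror w M d c → s ≤ d → Clear f M c (s + c)
      clear-right {s} {c} μ s≤d z c<z z<s+c νz =
        too-close μ (mirrors νz) c<z (≤-trans z<s+c (+-monoˡ-≤ c s≤d))

      reflect≡ : ∀ {c} → Mid c → Node f M c → ∀ s k → s + k ≡ c → s ≤ d → f k ≡ f (s + c)
      reflect≡ (d≤0 , _) start _ _ _ _ = contradiction (≤-trans 0<d d≤0) λ ()
      reflect≡ (_ , d+M≤M , _) end _ _ _ _ =
        ⊥-elim (lin (d ∷ M ∷ []) (λ d M → # 1 ≼ d ⇒ d ⊕ M ≼ M ⇒ ⊢ false′) 0<d d+M≤M)
      reflect≡ {c} m@(_ , d+c≤M , _) (turn _ _ eq) s k s+k≡c s≤d =
        reflect-turn strict s k c s+k≡c (≤-trans (+-monoˡ-≤ c s≤d) d+c≤M) eq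
          (clear-left (mid-mirror m) s+k≡c s≤d) (clear-right (mid-mirror m) s≤d)

      through : ∀ {c} → Mid c → ¬ Node f M c → ∀ s k → s + k ≡ c → s ≤ d → Straight f k (s + s)
      through m@(_ , d+c≤M , _) ¬ν s k refl s≤d = straight strict k (s + s)
        (subst (_≤ M) (sym (+-assoc s s k)) (≤-trans (+-monoˡ-≤ (s + k) s≤d) d+c≤M)) clear
        where
        clear : Clear f M k (s + s + k)
        clear z k<z z< νz with <-cmp z (s + k)
        ... | tri< z<c _ _ = clear-left (mid-mirror m) refl s≤d z k<z z<c νz
        ... | tri≈ _ refl _ = ¬ν νz
        ... | tri> _ _ c<z = clear-right (mid-mirror m) s≤d z c<z (subst (z <_) (+-assoc s s k) z<) νz

      through-seg : ∀ {c} → Mid c → ¬ Node f M c → ∀ s k → s + k ≡ c → s ≤ d →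
        (f (s + c) ≡ s + s + f k × SegPal u (f k) (f (s + c))) ⊎
        (f k ≡ s + s + f (s + c) × SegPal u (f (s + c)) (f k))
      through-seg m@(_ , d+c≤M , pal) ¬ν s k refl s≤d =
        subst (λ x → (f x ≡ s + s + f k × SegPal u (f k) (f x)) ⊎ (f k ≡ s + s + f x × SegPal u (f x) (f k)))
          (+-assoc s s k)
          (straight-seg {u} {w} k (s + s)
            (λ t t≤ → fw (t + k) (≤-trans (+-monoˡ-≤ k t≤) s+s+k≤M))
            (subst (SegPal w k) (sym (+-assoc s s k)) (pal-seg {w} pal s k refl s≤d))
            (through m ¬ν s k refl s≤d))
        where
        s+s+k≤M : s + s + k ≤ M
        s+s+k≤M = subst (_≤ M) (sym (+-assoc s s k)) (≤-trans (+-monoˡ-≤ (s + k) s≤d) d+c≤M)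

      -- If `f` turns at `c`, the two values are equal. Otherwise `f` copies the palindrome around
      -- `c` into `u`, and the values are the ends of a palindromic factor of `u`.
      reflect~ : ∀ {c} → Mid c → Reflects (λ i j → f i ~ f j) c d
      reflect~ {c} m s k s+k≡c s≤d with node? f M c (mirror-bound (mid-mirror m))
      ... | yes ν = ~≡ (reflect≡ m ν s k s+k≡c s≤d)
      reflect~ {c} m zero k refl s≤d | no ¬ν = ~refl
      reflect~ {c} m@(_ , d+c≤M , _) s@(suc _) k s+k≡c s≤d | no ¬ν with through-seg m ¬ν s k s+k≡c s≤d
      ... | inj₁ (eq , seg) = pal~ _ _ (subst (f k <_) (sym eq) (m<n+m (f k) (s≤s z≤n)))
              (bound _ (≤-trans (+-monoˡ-≤ c s≤d) d+c≤M)) seg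
      ... | inj₂ (eq , seg) = ~sym (pal~ _ _ (subst (f (s + c) <_) (sym eq) (m<n+m (f (s + c)) (s≤s z≤n)))
              (bound k (≤-trans (m+n≤o⇒n≤o s (≤-reflexive s+k≡c)) (mirror-bound (mid-mirror m)))) seg)

      -- Crossing `c` without turning makes `f c` an inner mirror of `u` of radius `d`, with the
      -- images of the two positions at distance `d` from `c` lying at distance `d` from it.
      pass : ∀ {c} → Mid c → ¬ Node f M c → ∀ k → d + k ≡ c →
             (Pal u (f c) d × d ≤ f c × d + f c ≤ N) × Apart d (f c) (f k) × Apart d (f c) (f (d + c))
      pass {c} m@(_ , d+c≤M , _) ¬ν k refl = go (through m ¬ν d k refl ≤-refl) (through-seg m ¬ν d k refl ≤-refl)
        where
        image : ∀ {i j y} → SegPal u i j → j ≡ d + (d + i) → y ≡ d + i → j ≤ N →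
                Pal u y d × d ≤ y × d + y ≤ N
        image seg refl refl j≤N = seg-pal seg refl , m≤m+n d _ , j≤N
        x = f k
        y = f (d + k)
        z = f (d + (d + k))
        go : Straight f k (d + d) →
             (z ≡ d + d + x × SegPal u x z) ⊎ (x ≡ d + d + z × SegPal u z x) →
             (Pal u y d × d ≤ y × d + y ≤ N) × Apart d y x × Apart d y z
        go (up h) (inj₁ (eq , seg)) = image seg (trans eq (+-assoc d d x)) y≡ (bound _ d+c≤M) ,
          inj₁ y≡ , inj₂ (trans eq (trans (+-assoc d d x) (cong (d +_) (sym y≡))))
          where
          y≡ : y ≡ d + x
          y≡ = h d (m≤m+n d d)
        go (down h) (inj₂ (eq , seg)) =
          image seg (trans eq (+-assoc d d z)) y≡ (bound k (m+n≤o⇒n≤o d (m+n≤o⇒n≤o d d+c≤M))) ,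
          inj₂ (sym (h d (m≤m+n d d))) , inj₁ y≡
          where
          y≡ : y ≡ d + z
          y≡ = lin (d ∷ x ∷ y ∷ z ∷ [])
            (λ d x y z → d ⊕ y ≈ x ⇒ x ≈ d ⊕ d ⊕ z ⇒ ⊢ y ≈ d ⊕ z) (h d (m≤m+n d d)) eq
        go (up h) (inj₂ (eq , _)) = ⊥-elim (lin (d ∷ x ∷ f (d + d + k) ∷ z ∷ [])
          (λ d x y z → # 1 ≼ d ⇒ y ≈ d ⊕ d ⊕ x ⇒ x ≈ d ⊕ d ⊕ z ⇒ y ≈ z ⇒ d ≼ d ⊕ d ⇒ ⊢ false′)
          0<d (h (d + d) ≤-refl) eq (cong f (+-assoc d d k)) (m≤m+n d d))
        go (down h) (inj₁ (eq , _)) = ⊥-elim (lin (d ∷ x ∷ f (d + d + k) ∷ z ∷ [])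
          (λ d x y z → # 1 ≼ d ⇒ d ⊕ d ⊕ y ≈ x ⇒ z ≈ d ⊕ d ⊕ x ⇒ y ≈ z ⇒ ⊢ false′)
          0<d (h (d + d) ≤-refl) eq (cong f (+-assoc d d k)))

      -- A walk passing straight over a mirror cannot have an end of u at distance d from it, since
      -- u would have a palindromic prefix or suffix.
      no-extreme-pass : ∀ {y z} → Pal u y d × d ≤ y × d + y ≤ N → Apart d y z → ¬ Extreme N z
      no-extreme-pass (pal , d≤y , d+y≤N) (inj₁ refl) (inj₁ refl) = no-fold d (fold 0 0<d
        (lin (d ∷ N ∷ []) (λ d N → # 1 ≼ d ⇒ d ⊕ (d ⊕ # 0) ≼ N ⇒ ⊢ # 1 ⊕ d ≼ N) 0<d d+y≤N)
        (m+n≤o⇒n≤o d d+y≤N) start (mid d≤y d+y≤N pal))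
      no-extreme-pass {y} (pal , d≤y , d+y≤N) (inj₂ eq) (inj₁ refl) =
        lin (d ∷ y ∷ []) (λ d y → # 1 ≼ d ⇒ # 0 ≈ d ⊕ y ⇒ ⊢ false′) 0<d eq
      no-extreme-pass (pal , d≤y , d+y≤N) (inj₁ refl) (inj₂ refl) =
        lin (d ∷ N ∷ []) (λ d N → # 1 ≼ d ⇒ d ⊕ (d ⊕ N) ≼ N ⇒ ⊢ false′) 0<d d+y≤N
      no-extreme-pass {y} (pal , d≤y , d+y≤N) (inj₂ eq) (inj₂ refl) = no-fold d (fold y 0<d
        (lin (d ∷ y ∷ N ∷ []) (λ d y N → # 1 ≼ d ⇒ d ≼ y ⇒ d ⊕ y ≼ N ⇒ ⊢ # 1 ⊕ d ≼ N) 0<d d≤y d+y≤N)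
        d+y≤N (mid d≤y d+y≤N pal) (subst (Mirror u N d) eq end))

      -- Two palindromes of radius `d` with centres `d` apart are a fold of `u`.
      no-double-pass : ∀ {y z} → Pal u y d × d ≤ y × d + y ≤ N → Pal u z d × d ≤ z × d + z ≤ N → ¬ Apart d y z
      no-double-pass {y} {z} (pal , d≤y , d+y≤N) (pal′ , d≤z , d+z≤N) (inj₁ refl) = no-fold d (fold z 0<d
        (lin (d ∷ z ∷ N ∷ []) (λ d y N → # 1 ≼ d ⇒ d ≼ y ⇒ d ⊕ y ≼ N ⇒ ⊢ # 1 ⊕ d ≼ N) 0<d d≤z d+z≤N)
        d+z≤N (mid d≤z d+z≤N pal′) (mid d≤y d+y≤N pal))
      no-double-pass {y} {z} (pal , d≤y , d+y≤N) (pal′ , d≤z , d+z≤N) (inj₂ refl) = no-fold d (fold y 0<d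
        (lin (d ∷ y ∷ N ∷ []) (λ d y N → # 1 ≼ d ⇒ d ≼ y ⇒ d ⊕ y ≼ N ⇒ ⊢ # 1 ⊕ d ≼ N) 0<d d≤y d+y≤N)
        d+y≤N (mid d≤y d+y≤N pal) (mid d≤z d+z≤N pal′))

      extremes : ∀ x → x ≤ M → Extreme N (f x) → Node f M x
      extremes = extreme-node strict bound

      Lift : (r : ℕ → ℕ) (M′ : ℕ) → Set
      Lift r M′ = ∃ λ f′ → Walk M′ N f′ × (∀ i → i ≤ M → f′ (r i) ~ f i)

      -- The block [0,d) is dropped. Only its first position can be sent to an end of `u`; then `f`
      -- must turn at `d`, and position 2d has the same image.
      prefix-lift : ∀ b → M ≡ b + (d + d) → Pal w d d → Lift (bend 0 d 0) (b + d)
      prefix-lift b M≡ pal = (λ j → f (cut 0 d j)) ,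
        walk-cut W 0 d (b + d) (trans M≡ (lin (b ∷ d ∷ []) (λ b d → ⊢ b ⊕ (d ⊕ d) ≈ d ⊕ (b ⊕ d)))) z≤n (inj₁ refl) keep ,
        λ i _ → ~sym (prefix-cover (On.isEquivalence f E) d (reflect~ m) i)
        where
        d+d≤M : d + d ≤ M
        d+d≤M = ≤-trans (m≤n+m (d + d) b) (≤-reflexive (sym M≡))
        m : Mid d
        m = ≤-refl , d+d≤M , pal
        keep : ∀ x → x ≤ M → Extreme N (f x) → 0 ≤ x → x < d + 0 →
               ∃ λ x′ → x′ ≤ M × (x′ < 0 ⊎ d + 0 ≤ x′) × f x′ ≡ f x
        keep zero _ ext _ _ with node? f M d (<⇒≤ d<M)
        ... | yes ν = d + d , d+d≤M , inj₂ (+-monoʳ-≤ d z≤n) , sym (reflect≡ m ν d 0 (+-identityʳ d) ≤-refl)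
        ... | no ¬ν with pass m ¬ν 0 (+-identityʳ d)
        ... | P , apart , _ = ⊥-elim (no-extreme-pass P apart ext)
        keep (suc x) x≤M ext _ x<d = ⊥-elim (clear-left (mid-mirror m) (+-identityʳ d) ≤-refl (suc x) (s≤s z≤n)
          (subst (suc x <_) (+-identityʳ d) x<d) (extremes (suc x) x≤M ext))

      -- Mirror image of the prefix case: restricting `f` to [0,d+a] can lose an end of `u` only at
      -- the last position, which is recovered at `a`.
      suffix-lift : ∀ a → M ≡ d + (d + a) → Pal w (d + a) d → Lift (bend (d + a) d a) (d + a)
      suffix-lift a M≡ pal = f ,
        walk (λ i i<V → step i (≤-trans i<V V≤M)) (λ i i≤V → bound i (≤-trans i≤V V≤M)) hit′ ,
        λ i i≤M → ~sym (suffix-cover (On.isEquivalence f E) d a (reflect~ m) i (≤-trans i≤M (≤-reflexive M≡)))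
        where
        V≤M : d + a ≤ M
        V≤M = ≤-trans (m≤n+m (d + a) d) (≤-reflexive (sym M≡))
        m : Mid (d + a)
        m = m≤m+n d a , ≤-reflexive (sym M≡) , pal
        hit′ : ∀ y → Extreme N y → ∃ λ x → x ≤ d + a × f x ≡ y
        hit′ y ext with hit y ext
        ... | x , x≤M , refl with x ≤? d + a
        ... | yes x≤V = x , x≤V , refl
        ... | no x≰V with m≤n⇒m<n∨m≡n x≤M
        ... | inj₁ x<M = ⊥-elim (clear-right (mid-mirror m) ≤-refl x (≰⇒> x≰V) (subst (x <_) M≡ x<M) (extremes x x≤M ext))
        ... | inj₂ x≡M with node? f M (d + a) V≤M
        ... | yes ν = a , m≤n+m a d , trans (reflect≡ m ν d a refl ≤-refl) (cong f (sym (trans x≡M M≡)))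
        ... | no ¬ν with pass m ¬ν a refl
        ... | P , _ , apart = ⊥-elim (no-extreme-pass P apart (subst (λ x → Extreme N (f x)) (trans x≡M M≡) ext))

      -- `f` must turn at `V` or at `X`, for otherwise both palindromes would be copied into `u`. A
      -- turn at `V` gives `f` equal values at `a` and `X`, so [a,X) is cut out; a turn at `X` gives
      -- equal values at `V` and `Y`, so [V,Y) is cut out.
      zigzag-lift : ∀ a b → M ≡ b + (d + (d + (d + a))) → Pal w (d + a) d → Pal w (d + (d + a)) d →
                    Lift (bend (d + a) d a) (b + (d + a))
      zigzag-lift a b M≡ palV palW = go (node? f M V V≤M) (node? f M X X≤M)
        where
        V = d + a
        X = d + V
        Y = d + X
        Y≤M : Y ≤ M
        Y≤M = ≤-trans (m≤n+m Y b) (≤-reflexive (sym M≡))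
        X≤M : X ≤ M
        X≤M = m+n≤o⇒n≤o d Y≤M
        V≤M : V ≤ M
        V≤M = m+n≤o⇒n≤o d X≤M
        mV : Mid V
        mV = m≤m+n d a , X≤M , palV
        mX : Mid X
        mX = m≤m+n d V , Y≤M , palW
        M≡′ : M ≡ d + d + (b + (d + a))
        M≡′ = trans M≡ (lin (a ∷ b ∷ d ∷ []) (λ a b d → ⊢ b ⊕ (d ⊕ (d ⊕ (d ⊕ a))) ≈ d ⊕ d ⊕ (b ⊕ (d ⊕ a))))

        over : ∀ p → a ≤ p → p ≤ V → ∀ i → i ≤ M → f (cut p (d + d) (bend V d a i)) ~ f i
        over p a≤p p≤V i _ = ~sym (zigzag-cover (On.isEquivalence f E) d a (reflect~ mV) (reflect~ mX) p a≤p p≤V i)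

        -- An end of `u` can be reached in [a,X) only at `a`, where `X` replaces it, or at `V`. In
        -- the latter case `f` cannot pass straight over `X`, so `Y` replaces `V`.
        keep-a : Node f M V → ∀ x → x ≤ M → Extreme N (f x) → a ≤ x → x < d + d + a →
                 ∃ λ x′ → x′ ≤ M × (x′ < a ⊎ d + d + a ≤ x′) × f x′ ≡ f x
        keep-a νV x x≤M ext a≤x x<X with m≤n⇒m<n∨m≡n a≤x
        ... | inj₂ refl = X , X≤M , inj₂ (≤-reflexive (+-assoc d d a)) , sym (reflect≡ mV νV d a refl ≤-refl)
        ... | inj₁ a<x with <-cmp x V
        ... | tri< x<V _ _ = ⊥-elim (clear-left (mid-mirror mV) refl ≤-refl x a<x x<V (extremes x x≤M ext))
        ... | tri> _ _ V<x = ⊥-elim (clear-right (mid-mirror mV) ≤-refl x V<x (subst (x <_) (+-assoc d d a) x<X) (extremes x x≤M ext))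
        ... | tri≈ _ refl _ with node? f M X X≤M
        ... | yes νX = Y , Y≤M , inj₂ (≤-trans (≤-reflexive (+-assoc d d a)) (m≤n+m X d)) , sym (reflect≡ mX νX d V refl ≤-refl)
        ... | no ¬νX with pass mX ¬νX V refl
        ... | P , apart , _ = ⊥-elim (no-extreme-pass P apart ext)

        -- Here the candidates are `V`, replaced by `Y`, and `X`, which is impossible because `f`
        -- passes straight over `V`.
        keep-V : Node f M X → ¬ Node f M V → ∀ x → x ≤ M → Extreme N (f x) → V ≤ x → x < d + d + V →
                 ∃ λ x′ → x′ ≤ M × (x′ < V ⊎ d + d + V ≤ x′) × f x′ ≡ f x
        keep-V νX ¬νV x x≤M ext V≤x x<Y with m≤n⇒m<n∨m≡n V≤x
        ... | inj₂ refl = Y , Y≤M , inj₂ (≤-reflexive (+-assoc d d V)) , sym (reflect≡ mX νX d V refl ≤-refl)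
        ... | inj₁ V<x with <-cmp x X
        ... | tri< x<X _ _ = ⊥-elim (clear-left (mid-mirror mX) refl ≤-refl x V<x x<X (extremes x x≤M ext))
        ... | tri> _ _ X<x = ⊥-elim (clear-right (mid-mirror mX) ≤-refl x X<x (subst (x <_) (+-assoc d d V) x<Y) (extremes x x≤M ext))
        ... | tri≈ _ refl _ with pass mV ¬νV a refl
        ... | P , _ , apart = ⊥-elim (no-extreme-pass P apart ext)

        go : Dec (Node f M V) → Dec (Node f M X) → Lift (bend V d a) (b + V)
        go (yes νV) _ = (λ j → f (cut a (d + d) j)) ,
          walk-cut W a (d + d) (b + V) M≡′ (≤-trans (m≤n+m a d) (m≤n+m V b))
            (inj₂ (trans (reflect≡ mV νV d a refl ≤-refl) (cong f (sym (+-assoc d d a))))) (keep-a νV) ,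
          over a ≤-refl (m≤n+m a d)
        go (no ¬νV) (yes νX) = (λ j → f (cut V (d + d) j)) ,
          walk-cut W V (d + d) (b + V) M≡′ (m≤n+m V b)
            (inj₂ (trans (reflect≡ mX νX d V refl ≤-refl) (cong f (sym (+-assoc d d V))))) (keep-V νX ¬νV) ,
          over V (m≤n+m a d) ≤-refl
        go (no ¬νV) (no ¬νX) = ⊥-elim (no-double-pass (proj₁ (pass mV ¬νV a refl)) (proj₁ (pass mX ¬νX V refl))
          (proj₂ (proj₂ (pass mV ¬νV a refl))))

  fold-lifts : ∀ {w M d} → (∀ i → i < M → ¬ w i ≡ w (suc i)) → (∀ e → e < d → ¬ Fold w M e) →
               (φ : Fold w M d) → Lifts (fold-retract φ)
  fold-lifts w-strict minimal φ f W fw with shape φ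
  ... | prefix b refl pal = prefix-lift b refl pal
    where open OnWalk.Minimal w-strict W fw (Fold.0<d φ) (Fold.d<M φ) minimal
  ... | suffix a refl pal = suffix-lift a refl pal
    where open OnWalk.Minimal w-strict W fw (Fold.0<d φ) (Fold.d<M φ) minimal
  ... | zigzag a b refl palV palW = zigzag-lift a b refl palV palW
    where open OnWalk.Minimal w-strict W fw (Fold.0<d φ) (Fold.d<M φ) minimal

  -- Words without folds and the induction on length

  Antipodal : Set
  Antipodal = ∀ p q → p + q ≡ N → u p ≡ u q

  -- When `u` is a palindrome, so is each factor concentric with it.
  antipodes~ : Antipodal → ∀ p q → p + q ≡ N → p ~ q
  antipodes~ anti p q p+q≡N with <-cmp p q
  ... | tri≈ _ refl _ = ~refl
  ... | tri< p<q _ _ = pal~ p q p<q (m+n≤o⇒n≤o p (≤-reflexive p+q≡N)) λ t t′ eq →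
    anti (t + p) (t′ + p) (lin (p ∷ q ∷ N ∷ t ∷ t′ ∷ [])
      (λ p q N t t′ → p ⊕ q ≈ N ⇒ t ⊕ (t′ ⊕ p) ≈ q ⇒ ⊢ t ⊕ p ⊕ (t′ ⊕ p) ≈ N) p+q≡N eq)
  ... | tri> _ _ q<p = ~sym (pal~ q p q<p (m+n≤o⇒m≤o p (≤-reflexive p+q≡N)) λ t t′ eq →
    anti (t + q) (t′ + q) (lin (p ∷ q ∷ N ∷ t ∷ t′ ∷ [])
      (λ p q N t t′ → p ⊕ q ≈ N ⇒ t ⊕ (t′ ⊕ q) ≈ p ⇒ ⊢ t ⊕ q ⊕ (t′ ⊕ q) ≈ N) p+q≡N eq))

  data Direct (M : ℕ) (f : ℕ → ℕ) : Set where
    ascending  : (∀ i → i ≤ M → f i ≡ i) → Direct M f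
    descending : (∀ i → i ≤ M → i + f i ≡ N) → Direct M f

  -- A straight walk must begin at one end of [0,N] and finish at the other in order to reach both.
  straight-direct : ∀ {M f} → Walk M N f → Straight f 0 M → M ≡ N × Direct M f
  straight-direct {M} {f} (walk step bound hit) (up h) with hit 0 (inj₁ refl) | hit N (inj₂ refl)
  ... | x , x≤M , fx≡0 | y , y≤M , fy≡N = M≡N , ascending λ i i≤M → trans (h′ i i≤M) (trans (cong (i +_) f0≡0) (+-identityʳ i))
    where
    h′ : ∀ s → s ≤ M → f s ≡ s + f 0
    h′ s s≤M = trans (cong f (sym (+-identityʳ s))) (h s s≤M)
    f0≡0 : f 0 ≡ 0
    f0≡0 = m+n≡0⇒n≡0 x (trans (sym (h′ x x≤M)) fx≡0)
    M≡N : M ≡ N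
    M≡N = ≤-antisym
      (lin (M ∷ N ∷ f 0 ∷ f M ∷ []) (λ M N x y → y ≈ M ⊕ x ⇒ y ≼ N ⇒ ⊢ M ≼ N) (h′ M ≤-refl) (bound M ≤-refl))
      (lin (M ∷ N ∷ f 0 ∷ f y ∷ y ∷ []) (λ M N x z y → z ≈ y ⊕ x ⇒ x ≈ # 0 ⇒ z ≈ N ⇒ y ≼ M ⇒ ⊢ N ≼ M)
        (h′ y y≤M) f0≡0 fy≡N y≤M)
  straight-direct {M} {f} (walk step bound hit) (down h) with hit 0 (inj₁ refl) | hit N (inj₂ refl)
  ... | x , x≤M , fx≡0 | y , y≤M , fy≡N = M≡N , descending λ i i≤M → trans (h′ i i≤M) f0≡N
    where
    h′ : ∀ s → s ≤ M → s + f s ≡ f 0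
    h′ s s≤M = trans (cong (λ x → s + f x) (sym (+-identityʳ s))) (h s s≤M)
    f0≡N : f 0 ≡ N
    f0≡N = ≤-antisym (bound 0 z≤n)
      (lin (N ∷ f 0 ∷ f y ∷ y ∷ []) (λ N x z y → y ⊕ z ≈ x ⇒ z ≈ N ⇒ ⊢ N ≼ x) (h′ y y≤M) fy≡N)
    M≡N : M ≡ N
    M≡N = ≤-antisym
      (lin (M ∷ N ∷ f 0 ∷ f M ∷ []) (λ M N x y → M ⊕ y ≈ x ⇒ x ≈ N ⇒ ⊢ M ≼ N) (h′ M ≤-refl) f0≡N)
      (lin (M ∷ N ∷ f 0 ∷ f x ∷ x ∷ []) (λ M N t z x → x ⊕ z ≈ t ⇒ z ≈ # 0 ⇒ t ≈ N ⇒ x ≼ M ⇒ ⊢ N ≼ M)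
        (h′ x x≤M) fx≡0 f0≡N x≤M)

  unfolded-direct : ∀ {w M} → (∀ i → i < M → ¬ w i ≡ w (suc i)) → (∀ e → ¬ Fold w M e) →
                    ∀ {f} → Walk M N f → (∀ i → i ≤ M → u (f i) ≡ w i) → M ≡ N × Direct M f
  unfolded-direct {w} {M} w-strict unfolded {f} W fw =
    straight-direct W (straight strict 0 M (≤-reflexive (+-identityʳ M)) clear)
    where
    open OnWalk w-strict W fw
    clear : Clear f M 0 (M + 0)
    -- Without folds, distinct nodes other than the pair of ends would be more than `M` apart.
    clear z 0<z z<M ν = lin (M ∷ z ∷ []) (λ M z → # 1 ⊕ z ≼ M ⊕ # 0 ⇒ # 1 ⊕ (M ⊕ # 0) ≼ z ⇒ ⊢ false′) z<M
      (spaced (suc M) (λ e _ → unfolded e) 0 z start ν 0<z z<M)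

  Coincide : ℕ → Set
  Coincide M = ∀ f g → Walk M N f → Walk M N g → (∀ i → i ≤ M → u (f i) ≡ u (g i)) → ∀ i → i ≤ M → f i ~ g i

  -- The identity and the reversal spell the same word only if `u` is a palindrome, and then
  -- antipodes are related.
  opposite-coincide : ∀ (f g : ℕ → ℕ) → (∀ i → i ≤ N → f i ≡ i) → (∀ i → i ≤ N → i + g i ≡ N) →
                      (∀ i → i ≤ N → u (f i) ≡ u (g i)) → ∀ i → i ≤ N → f i ~ g i
  opposite-coincide f g p q eq i i≤N =
    antipodes~ anti (f i) (g i) (trans (cong (_+ g i) (p i i≤N)) (q i i≤N))
    where
    anti : Antipodal
    anti a b a+b≡N = trans (cong u (sym (p a a≤N))) (trans (eq a a≤N)
      (cong u (+-cancelˡ-≡ a _ _ (trans (q a a≤N) (sym a+b≡N)))))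
      where
      a≤N : a ≤ N
      a≤N = m+n≤o⇒m≤o a (≤-reflexive a+b≡N)

  direct-coincide : ∀ {M f g} → M ≡ N → Direct M f → Direct M g → (∀ i → i ≤ M → u (f i) ≡ u (g i)) →
                    ∀ i → i ≤ M → f i ~ g i
  direct-coincide _ (ascending p) (ascending q) _ i i≤M = ~≡ (trans (p i i≤M) (sym (q i i≤M)))
  direct-coincide _ (descending p) (descending q) _ i i≤M =
    ~≡ (+-cancelˡ-≡ i _ _ (trans (p i i≤M) (sym (q i i≤M))))
  direct-coincide {f = f} {g} refl (ascending p) (descending q) eq i i≤N = opposite-coincide f g p q eq i i≤N
  direct-coincide {f = f} {g} refl (descending p) (ascending q) eq i i≤N =
    ~sym (opposite-coincide g f q p (λ i i≤N → sym (eq i i≤N)) i i≤N)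

  -- The lifted walks spell the same shorter word, as one sees by evaluating at `e j`: `~` preserves
  -- letters and `e` is a section of `r`. The induction hypothesis then applies to them.
  descend : ∀ {M f g} → (R : Retract (λ i → u (f i)) M) → Lifts R → Coincide (Retract.M′ R) →
            Walk M N f → Walk M N g → (∀ i → i ≤ M → u (f i) ≡ u (g i)) → ∀ i → i ≤ M → f i ~ g i
  descend {M} {f} {g} R lifts ih F G eq i i≤M
    with lifts f F (λ _ _ → refl) | lifts g G (λ i i≤M → sym (eq i i≤M))
  ... | f′ , F′ , f′~f | g′ , G′ , g′~g =
    ~trans (~sym (f′~f i i≤M)) (~trans (ih f′ g′ F′ G′ agree (r i) (r-bound i i≤M)) (g′~g i i≤M))
    where
    open Retract R
    agree : ∀ j → j ≤ M′ → u (f′ j) ≡ u (g′ j)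
    agree j j≤M′ = subst (λ k → u (f′ k) ≡ u (g′ k)) (r∘e j j≤M′)
      (trans (~⇒≡ (f′~f (e j) (e-bound j j≤M′))) (trans (eq (e j) (e-bound j j≤M′))
        (sym (~⇒≡ (g′~g (e j) (e-bound j j≤M′))))))

  coincide : ∀ M → Coincide M
  coincide = <-rec Coincide go
    where
    go : ∀ M → (∀ {M′} → M′ < M → Coincide M′) → Coincide M
    go M ih f g F G eq with anyUpTo? (λ i → u (f i) ≟ u (f (suc i))) M
    ... | yes (x , s≤s x≤M , stutter) =
      descend (stutter-retract {λ i → u (f i)} x≤M stutter) (stutter-lifts {λ i → u (f i)} x≤M stutter) (ih ≤-refl) F G eq
    ... | no ¬stutter with least (fold? (λ i → u (f i)) M) M
    ... | inj₁ (d , φ , minimal) =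
      descend (fold-retract φ) (fold-lifts (λ i i<M p → ¬stutter (i , i<M , p)) minimal φ)
        (ih (Retract.M′<M (fold-retract φ))) F G eq
    ... | inj₂ unfolded = direct-coincide (proj₁ (direct F (λ _ _ → refl))) (proj₂ (direct F (λ _ _ → refl)))
          (proj₂ (direct G (λ i i≤M → sym (eq i i≤M)))) eq
      where
      direct : ∀ {h} → Walk M N h → (∀ i → i ≤ M → u (h i) ≡ u (f i)) → M ≡ N × Direct M h
      -- The search for folds stopped at `M`, which suffices because a fold has radius below `M`.
      direct = unfolded-direct (λ i i<M p → ¬stutter (i , i<M , p)) (λ e φ → unfolded e (Fold.d<M φ) φ)

-- Words as vectors

-- Numbers beyond `N` go to the last position; this default makes words and walks total functions on
-- ℕ.
clamp : ∀ N → ℕ → Fin (suc N)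
clamp zero _ = zero
clamp (suc N) zero = zero
clamp (suc N) (suc k) = suc (clamp N k)

toℕ-clamp : ∀ {N k} → k ≤ N → toℕ (clamp N k) ≡ k
toℕ-clamp {zero} z≤n = refl
toℕ-clamp {suc N} z≤n = refl
toℕ-clamp {suc N} (s≤s k≤N) = cong suc (toℕ-clamp k≤N)

clamp-toℕ : ∀ {N} (i : Fin (suc N)) → clamp N (toℕ i) ≡ i
clamp-toℕ {zero} zero = refl
clamp-toℕ {suc N} zero = refl
clamp-toℕ {suc N} (suc i) = cong suc (clamp-toℕ i)

toℕ≤ : ∀ {N} (i : Fin (suc N)) → toℕ i ≤ N
toℕ≤ i = ≤-pred (Fin.toℕ<n i)

applyDownFrom-≡-applyUpTo : ∀ {A : Set} {φ ψ : ℕ → A} n → (∀ s t → suc (s + t) ≡ n → φ s ≡ ψ t) →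
                            applyDownFrom φ n ≡ applyUpTo ψ n
applyDownFrom-≡-applyUpTo zero _ = refl
applyDownFrom-≡-applyUpTo (suc n) h = cong₂ List._∷_ (h n 0 (cong suc (+-identityʳ n)))
  (applyDownFrom-≡-applyUpTo n λ s t eq → h s (suc t) (cong suc (trans (+-suc s t) eq)))

take-drop-toList : ∀ {A : Set} {N} (u : Vec A (suc N)) i L → i + L ≤ suc N →
                   take L (drop i (toList u)) ≡ applyUpTo (λ t → lookup u (clamp N (i + t))) L
take-drop-toList u zero zero _ = refl
take-drop-toList {N = zero} (x ∷ []) zero (suc zero) _ = refl
take-drop-toList {N = zero} (x ∷ []) zero (suc (suc L)) (s≤s ())
take-drop-toList {N = suc N} (x ∷ u) zero (suc L) (s≤s L≤N) = cong (x List.∷_) (take-drop-toList u zero L L≤N)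
take-drop-toList {N = zero} (x ∷ []) (suc zero) zero _ = refl
take-drop-toList {N = zero} (x ∷ []) (suc (suc i)) L (s≤s ())
take-drop-toList {N = zero} (x ∷ []) (suc zero) (suc L) (s≤s ())
take-drop-toList {N = suc N} (x ∷ u) (suc i) L (s≤s i+L≤N) = take-drop-toList u i L i+L≤N

module _ {A : Set} {N : ℕ} (u : Vec A (suc N)) (i j : Fin (suc N)) (i<j : toℕ i < toℕ j) where
  private
    L = toℕ j ∸ toℕ i

    letter : ℕ → A
    letter t = lookup u (clamp N (toℕ i + t))

    i+L≡j : toℕ i + L ≡ toℕ j
    i+L≡j = m+[n∸m]≡n (<⇒≤ i<j)

    factor≡ : factor u i j ≡ applyUpTo letter (suc L)
    factor≡ = take-drop-toList u (toℕ i) (suc L)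
      (≤-trans (≤-reflexive (trans (+-suc (toℕ i) L) (cong suc i+L≡j))) (Fin.toℕ<n j))

    reverse-factor≡ : reverse (factor u i j) ≡ applyDownFrom letter (suc L)
    reverse-factor≡ = trans (cong reverse factor≡) (List.reverse-applyUpTo letter (suc L))

  symmetric-defect : (∀ s t → s + (t + toℕ i) ≡ toℕ j →
                       lookup u (clamp N (s + toℕ i)) ≡ lookup u (clamp N (t + toℕ i))) → Defect u i j
  symmetric-defect h = i<j , trans reverse-factor≡ (trans (applyDownFrom-≡-applyUpTo (suc L) same) (sym factor≡))
    where
    same : ∀ s t → suc (s + t) ≡ suc L → letter s ≡ letter t
    same s t eq = subst₂ (λ x y → lookup u (clamp N x) ≡ lookup u (clamp N y)) (+-comm s _) (+-comm t _)
      (h s t (trans (sym (+-assoc s t _)) (trans (cong (_+ toℕ i) (suc-injective eq)) (trans (+-comm L _) i+L≡j))))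

  -- Compare the first letters of the factor and of its reversal.
  palindrome-ends : reverse (factor u i j) ≡ factor u i j → lookup u i ≡ lookup u j
  palindrome-ends eq = subst₂ (λ x y → lookup u x ≡ lookup u y)
    (trans (cong (clamp N) (+-identityʳ (toℕ i))) (clamp-toℕ i))
    (trans (cong (clamp N) i+L≡j) (clamp-toℕ j))
    (sym (List.∷-injectiveˡ (trans (sym reverse-factor≡) (trans eq factor≡))))

-- Carrying equal letters is an equivalence relation that contains every defect, hence it contains
-- the closure.
Δ*-lookup : ∀ {A : Set} {n} (u : Vec A n) {i j} → Δ* u i j → lookup u i ≡ lookup u j
Δ*-lookup {n = suc _} u = EqClosure.fold (On.isEquivalence (lookup u) isEquivalence)
  λ { {i} {j} (i<j , pal) → palindrome-ends u i j i<j pal }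
Δ*-lookup {n = zero} u {()}

-- The identification of positions generated by f and g; it replaces the alphabet, whose
-- equality need not be decidable, by the positions themselves.
identify : ∀ {n m} (f g : Fin m → Fin n) → ∃ λ (c : Fin n → Fin n) →
           (∀ i → c (f i) ≡ c (g i)) ×
           (∀ {A : Set} (h : Fin n → A) → (∀ i → h (f i) ≡ h (g i)) → ∀ x → h (c x) ≡ h x)
identify {m = zero} f g = (λ x → x) , (λ ()) , λ _ _ _ → refl
identify {n} {suc m} f g with identify (λ i → f (suc i)) (λ i → g (suc i))
... | c , same , inv = (λ x → redirect (c x)) , same′ , λ h eq x → trans (h-redirect h eq (c x)) (inv h (λ i → eq (suc i)) x)
  where
  a = c (f zero)
  b = c (g zero)
  -- One union step: the class represented by `a` is merged into that of `b`.
  redirect : Fin n → Fin n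
  redirect y with y Fin.≟ a
  ... | yes _ = b
  ... | no _ = y
  redirect-b : redirect b ≡ b
  redirect-b with b Fin.≟ a
  ... | yes _ = refl
  ... | no _ = refl
  redirect-a : redirect a ≡ b
  redirect-a with a Fin.≟ a
  ... | yes _ = refl
  ... | no a≢a = contradiction refl a≢a
  same′ : ∀ i → redirect (c (f i)) ≡ redirect (c (g i))
  same′ zero = trans redirect-a (sym redirect-b)
  same′ (suc i) = cong redirect (same i)
  h-redirect : ∀ {A : Set} (h : Fin n → A) → (∀ i → h (f i) ≡ h (g i)) → ∀ y → h (redirect y) ≡ h y
  h-redirect h eq y with y Fin.≟ a
  ... | no _ = refl
  ... | yes refl = trans (inv h (λ i → eq (suc i)) (g zero))
        (trans (sym (eq zero)) (sym (inv h (λ i → eq (suc i)) (f zero))))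

module _ {N M : ℕ} (f : Fin (suc M) → Fin (suc N)) where

  extend : ℕ → ℕ
  extend i = toℕ (f (clamp M i))

  extend-walk : IsWalk f → Walk M N extend
  extend-walk (surj , step) = walk
    (λ i i<M → step _ _ (trans (toℕ-clamp i<M) (cong suc (sym (toℕ-clamp (<⇒≤ i<M))))))
    (λ i _ → toℕ≤ _)
    λ { y ext → let x , eq = surj (clamp N y) in
        toℕ x , toℕ≤ x , trans (cong toℕ (trans (cong f (clamp-toℕ x)) eq)) (toℕ-clamp (extreme-≤ ext)) }
    where
    extreme-≤ : ∀ {y} → Extreme N y → y ≤ N
    extreme-≤ (inj₁ refl) = z≤n
    extreme-≤ (inj₂ refl) = ≤-refl

-- Equality in `w` is at least as fine as equality of letters of `u`, so a retraction of `w` also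
-- presents `u` as generated by a shorter word.
primitive⇒no-retract : ∀ {A : Set} {N} (u : Vec A (suc N)) → Primitive u → ∀ {w} →
  (∀ {i j} → w i ≡ w j → lookup u (clamp N i) ≡ lookup u (clamp N j)) → ¬ Retract w N
primitive⇒no-retract {A} {N} u prim {w} w⇒u R = prim (suc M′) v (s≤s M′<M) (ρ , (surj , step) , generates)
  where
  open Retract R
  ρ : Fin (suc N) → Fin (suc M′)
  ρ i = clamp M′ (r (toℕ i))
  toℕ-ρ : ∀ i → toℕ (ρ i) ≡ r (toℕ i)
  toℕ-ρ i = toℕ-clamp (r-bound _ (toℕ≤ i))
  letter : Fin (suc M′) → A
  letter j = lookup u (clamp N (e (toℕ j)))
  v : Vec A (suc M′)
  v = tabulate letter
  surj : ∀ y → ∃ λ x → ρ x ≡ y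
  surj y = clamp N (e (toℕ y)) , trans
    (cong (clamp M′) (trans (cong r (toℕ-clamp (e-bound _ (toℕ≤ y)))) (r∘e _ (toℕ≤ y)))) (clamp-toℕ y)
  step : ∀ i j → toℕ j ≡ suc (toℕ i) → Near (toℕ (ρ j)) (toℕ (ρ i))
  step i j eq rewrite toℕ-ρ i | toℕ-ρ j | eq = r-step (toℕ i) (subst (_≤ N) eq (toℕ≤ j))
  generates : v ^ ρ ≡ u
  generates = trans (tabulate-cong λ i → trans (lookup∘tabulate letter (ρ i))
      (trans (cong (λ j → lookup u (clamp N (e j))) (toℕ-ρ i))
        (trans (sym (w⇒u (w∘e∘r (toℕ i) (toℕ≤ i)))) (cong (lookup u) (clamp-toℕ i)))))
    (tabulate∘lookup u)

walks-coincide : ∀ {A : Set} {N M} (u : Vec A (suc N)) → Primitive u →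
  (f g : Fin (suc M) → Fin (suc N)) → IsWalk f → IsWalk g →
  (∀ i → lookup u (f i) ≡ lookup u (g i)) → ∀ i → Δ* u (f i) (g i)
walks-coincide {A} {N} {M} u prim f g F G eq i =
  subst₂ (Δ* u) (back f) (back g) (proj₂ (coincide M (extend f) (extend g) (extend-walk f F) (extend-walk g G) agree (toℕ i) (toℕ≤ i)))
  where
  c = proj₁ (identify f g)
  cf≡cg = proj₁ (proj₂ (identify f g))
  lookup-c : ∀ x → lookup u (c x) ≡ lookup u x
  lookup-c = proj₂ (proj₂ (identify f g)) (lookup u) eq

  -- The letters of `w` are representatives of classes of positions, so their equality is decidable.
  w : ℕ → ℕ
  w k = toℕ (c (clamp N k))

  w⇒u : ∀ {i j} → w i ≡ w j → lookup u (clamp N i) ≡ lookup u (clamp N j)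
  w⇒u eq = trans (sym (lookup-c _)) (trans (cong (lookup u) (Fin.toℕ-injective eq)) (lookup-c _))

  -- The first component is carried along because related positions must agree in `w`, whereas `Δ*`
  -- only ensures agreement in `u`.
  _~_ : ℕ → ℕ → Set
  i ~ j = w i ≡ w j × Δ* u (clamp N i) (clamp N j)

  ~-equivalence : IsEquivalence _~_
  ~-equivalence = record
    { refl = refl , EqClosure.reflexive _
    ; sym = λ (p , q) → sym p , EqClosure.symmetric _ q
    ; trans = λ (p , q) (p′ , q′) → trans p p′ , EqClosure.transitive _ q q′ }

  -- A palindromic segment of `w` is one of `u` as well, hence a defect.
  pal~ : ∀ i j → i < j → j ≤ N → SegPal w i j → i ~ j
  pal~ i j i<j j≤N seg = ends , EqClosure.return (symmetric-defect u (clamp N i) (clamp N j)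
      (subst₂ _<_ (sym i≡) (sym j≡) i<j)
      λ s t → subst₂ (λ i j → s + (t + i) ≡ j → lookup u (clamp N (s + i)) ≡ lookup u (clamp N (t + i)))
        (sym i≡) (sym j≡) λ eq → w⇒u (seg s t eq))
    where
    i≡ = toℕ-clamp (<⇒≤ (≤-trans i<j j≤N))
    j≡ = toℕ-clamp j≤N
    ends : w i ≡ w j
    ends = subst (λ x → w i ≡ w x) (m∸n+n≡m (<⇒≤ i<j)) (seg 0 (j ∸ i) (m∸n+n≡m (<⇒≤ i<j)))

  open Rigid (primitive⇒no-retract u prim w⇒u) ~-equivalence proj₁ pal~ using (coincide)

  agree : ∀ i → i ≤ M → w (toℕ (f (clamp M i))) ≡ w (toℕ (g (clamp M i)))
  agree i _ = cong toℕ (trans (cong c (clamp-toℕ _)) (trans (cf≡cg _) (cong c (sym (clamp-toℕ _)))))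

  back : ∀ (h : Fin (suc M) → Fin (suc N)) → clamp N (toℕ (h (clamp M (toℕ i)))) ≡ h i
  back h = trans (clamp-toℕ _) (cong h (clamp-toℕ i))

theorem3 : {A : Set} {n m : ℕ} (u : Vec A n) → Primitive u →
    (f g : Fin m → Fin n) → IsWalk f → IsWalk g →
    ((u ^ f) ≡ (u ^ g)) ⇔ (∀ (i : Fin m) → Δ* u (f i) (g i))
theorem3 {A} u prim f g F G = mk⇔ (to u prim f g F G) λ h → tabulate-cong λ i → Δ*-lookup u (h i)
  where
  to : ∀ {n m} (u : Vec A n) → Primitive u → (f g : Fin m → Fin n) → IsWalk f → IsWalk g →
       u ^ f ≡ u ^ g → ∀ i → Δ* u (f i) (g i)
  to {zero} u prim f g F G eq i with () ← f i
  to {suc N} {suc M} u prim f g F G eq = walks-coincide u prim f g F G λ i →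
    trans (sym (lookup∘tabulate (λ i → lookup u (f i)) i))
      (trans (cong (λ v → lookup v i) eq) (lookup∘tabulate (λ i → lookup u (g i)) i))
  to {suc N} {zero} u prim f g F G eq ()
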